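{- Let $w\in S_n$ be a permutation that avoids the patterns $1432$ and $1423$, and let $u$ be a subword of $w$. Then \[ \sum_{u\le v\le w} (-1)^{|w|-|v|}\, \mathfrak{S}_{\mathrm{perm}(v)}(\mathbf{1}) \ge 0, \] where the sum ranges over all words $v$ such that $u$ is a subword of $v$ and $v$ is a subword of $w$, and $\mathfrak{S}_{\pi}(\mathbf{1})$ denotes the value of the Schubert polynomial $\mathfrak{S}_\pi$ with all variables set to $1$.
   Context: Permutations are written in one-line notation and regarded as words; $|v|$ is the length of a word $v$. For words $u,v$, $u\le v$ means $u$ occurs as a subword of $v$, i.e. $u=v(i_1)\cdots v(i_{|u|})$ for some $1\le i_1<\dots<i_{|u|}\le|v|$ (the empty word is a subword of every word). A permutation $w$ avoids a pattern $\pi\in S_k$ if no subword of $w$ of length $k$ has its letters in the same relative order as $\pi$. For a word $v$ with distinct letters, $\mathrm{perm}(v)\in S_{|v|}$ is the permutation whose entries have the same relative order as the letters of $v$. -}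

module Defs where

open import Data.Nat as ℕ using (ℕ; zero; suc; _∸_; _<?_; _≤?_)
open import Data.Integer as ℤ using (ℤ; +_; -_)
open import Data.List using (List; []; _∷_; map; filter; length; _++_; upTo; downFrom; concatMap; foldr)
open import Data.Maybe using (Maybe; just; nothing)
open import Data.Product using (_×_; _,_; ∃; Σ)
open import Relation.Nullary using (¬_; yes; no)
open import Relation.Binary.PropositionalEquality using (_≡_)
open import Data.List.Relation.Binary.Sublist.DecPropositional ℕ._≟_ public
  using (_⊆_; _⊆?_)
open import Data.List.Relation.Binary.Permutation.Propositional public using (_↭_)

-- Words (with letters in ℕ); permutations in one-line notation.
Word : Set
Word = List ℕ

oneTo : ℕ → List ℕ
oneTo n = map suc (upTo n)

IsPerm : ℕ → Word → Set
IsPerm n w = w ↭ oneTo n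

perm : Word → Word
perm v = map (λ x → suc (length (filter (_<? x) v))) v

Contains : Word → Word → Set
Contains w π = Σ Word (λ s → (s ⊆ w) × (length s ≡ length π) × (perm s ≡ π))

Avoids : Word → Word → Set
Avoids w π = ¬ Contains w π

-- Polynomials in x₁, x₂, … with ℤ coefficients, as (unnormalised) lists
-- of terms (coefficient , exponent vector); the exponent list position
-- j (0-based) is the exponent of x_{j+1}; missing entries are 0.

Monomial : Set
Monomial = List ℕ

Poly : Set
Poly = List (ℤ × Monomial)

getE : ℕ → Monomial → ℕ
getE _       []       = 0
getE zero    (a ∷ _)  = a
getE (suc i) (_ ∷ e)  = getE i e

setE : ℕ → ℕ → Monomial → Monomial
setE zero    a []       = a ∷ []
setE zero    a (_ ∷ e)  = a ∷ e
setE (suc i) a []       = 0 ∷ setE i a []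
setE (suc i) a (b ∷ e)  = b ∷ setE i a e

-- Divided difference ∂_i f = (f - s_i f)/(x_i - x_{i+1}), here with the
-- 0-based index i acting on variables x_{i+1}, x_{i+2}, applied to a
-- term c·x_{i+1}^a x_{i+2}^b·(rest), written out explicitly:
--   a > b :  c · Σ_{k<a-b} x_{i+1}^{a-1-k} x_{i+2}^{b+k} · rest
--   a = b :  0
--   a < b : -c · Σ_{k<b-a} x_{i+1}^{a+k} x_{i+2}^{b-1-k} · rest
∂term : ℕ → ℤ × Monomial → Poly
∂term i (c , e) with getE i e | getE (suc i) e
... | a | b with b <? a
...   | yes _ = map (λ k → c , setE i (a ∸ 1 ∸ k) (setE (suc i) (b ℕ.+ k) e)) (upTo (a ∸ b))
...   | no _ with a <? b
...     | yes _ = map (λ k → - c , setE i (a ℕ.+ k) (setE (suc i) (b ∸ 1 ∸ k) e)) (upTo (b ∸ a))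
...     | no _  = []

∂ : ℕ → Poly → Poly
∂ i = concatMap (∂term i)

eval1 : Poly → ℤ
eval1 = foldr (λ t s → Data.Product.proj₁ t ℤ.+ s) (+ 0)

firstAscent : Word → Maybe ℕ
firstAscent []       = nothing
firstAscent (x ∷ w)  = go x w
  where
  go : ℕ → Word → Maybe ℕ
  go x []      = nothing
  go x (y ∷ w) with x <? y
  ... | yes _ = just 0
  ... | no _ with go y w
  ...   | just i  = just (suc i)
  ...   | nothing = nothing

swapAt : ℕ → Word → Word
swapAt zero    (x ∷ y ∷ w) = y ∷ x ∷ w
swapAt (suc i) (x ∷ w)     = x ∷ swapAt i w
swapAt _       w           = w

-- number of non-inversions (pairs i<j with w(i) < w(j)) = ℓ(w₀) - ℓ(w).
nonInv : Word → ℕ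
nonInv []      = 0
nonInv (x ∷ w) = length (filter (x <?_) w) ℕ.+ nonInv w

-- Schubert polynomial of π ∈ S_m, by the standard recursive definition
--   𝔖_{w₀} = x₁^{m-1} x₂^{m-2} ⋯ x_{m-1},
--   𝔖_w = ∂_i 𝔖_{w s_i}  whenever w(i) < w(i+1)
-- (using the first ascent; fuel = ℓ(w₀) - ℓ(w) guarantees termination).
schubGo : ℕ → ℕ → Word → Poly
schubGo m zero    w = (+ 1 , downFrom m) ∷ []
schubGo m (suc f) w with firstAscent w
... | nothing = (+ 1 , downFrom m) ∷ []
... | just i  = ∂ i (schubGo m f (swapAt i w))

schubert : Word → Poly
schubert π = schubGo (length π) (nonInv π) π

schubert1 : Word → ℤ
schubert1 π = eval1 (schubert π)

-- All subwords of w, one per subset of positions (for w with distinct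
-- letters these are exactly the distinct subwords of w).
subwords : Word → List Word
subwords []      = [] ∷ []
subwords (x ∷ w) = map (x ∷_) (subwords w) ++ subwords w

sgn : ℕ → ℤ
sgn zero    = + 1
sgn (suc k) = - sgn k

sumℤ : List ℤ → ℤ
sumℤ = foldr ℤ._+_ (+ 0)

intervalSum : Word → Word → ℤ
intervalSum u w =
  sumℤ (map (λ v → sgn (length w ∸ length v) ℤ.* schubert1 (perm v))
            (filter (u ⊆?_) (subwords w)))

{-# OPTIONS --safe #-}

-- For w avoiding 1432 and 1423, the Schubert polynomial factors over the columns of the
-- Rothe diagram: 𝔖_w = ∏_a Σ_{C ≤ D_a} x^C, where D_a is the set of positions to the left
-- of the letter a with a larger letter, and C ≤ D_a is the componentwise order on sets of
-- equal size.  This follows by descending along first ascents.  If w = l q p r with l q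
-- decreasing and q < p, then w' = l p q r avoids the two patterns as well.  Every column
-- factor of w' is symmetric in x_i and x_{i+1} (i = |l| + 1), except for the factor x_i of
-- column q and the columns a of r with q < a < p; the patterns allow at most one such a,
-- and on it f ↦ ∂_i (x_i f) is a Demazure operator taking the factor of w' to that of w.
--
-- The identities are checked at integer points with distinct coordinates, where the
-- denominators x_i - x_{i+1} can be cancelled.
--
-- At x = 1, the factor of column a counts the subwords of the prefix before a which are
-- Dyck words when letters < a are read as up steps and letters > a as down steps (C ↦ C Δ D_a).
-- So it is a sum over subwords with nonnegative coefficients.  This property is
-- inherited by products and makes all the alternating interval sums nonnegative.
module Submission where

open import Defs
open import Data.Bool using (Bool; true; false)
open import Data.Empty using (⊥; ⊥-elim)
open import Data.Integer as ℤ using (ℤ; +_; -_; _+_; _*_; _-_; _^_; _≤_; +≤+; ∣_∣)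
import Data.Integer.Properties as ℤₚ
open import Algebra.Properties.AbelianGroup ℤₚ.+-0-abelianGroup using (∙-cancelˡ)
open import Data.Integer.Tactic.RingSolver using (solve-∀)
open import Data.List using (List; []; _∷_; map; length; _++_; filter; upTo; applyUpTo; downFrom)
open import Data.List.Membership.Propositional using (_∈_; _∉_)
import Data.List.Properties as Listₚ
import Data.List.Relation.Binary.Permutation.Propositional as Perm
import Data.List.Relation.Binary.Permutation.Propositional.Properties as Permₚ
import Data.List.Relation.Binary.Permutation.Setoid.Properties as Permₛ
open import Data.List.Relation.Binary.Sublist.Propositional using ([]; _∷_; _∷ʳ_; from∈; to∈; ⊆-trans; lookup)
open import Data.List.Relation.Binary.Sublist.Propositional.Properties using (All-resp-⊆; ++⁺ˡ; ∷⁻; ∷ˡ⁻; length-mono-≤)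
open import Data.List.Relation.Unary.All as All using (All; []; _∷_)
import Data.List.Relation.Unary.All.Properties as Allₚ
open import Data.List.Relation.Unary.AllPairs using (AllPairs; []; _∷_)
open import Data.List.Relation.Unary.Any using (here; there)
import Data.List.Relation.Unary.Any.Properties as Anyₚ
open import Data.List.Relation.Unary.Unique.Propositional using (Unique)
import Data.List.Relation.Unary.Unique.Propositional.Properties as Uniqueₚ
open import Data.Maybe as Maybe using (Maybe; just; nothing)
open import Data.Nat as ℕ using (ℕ; zero; suc; _∸_; _<_; _>_; _<?_; s≤s; z≤n)
import Data.Nat.Properties as ℕₚ
open import Algebra.Properties.CommutativeSemigroup ℕₚ.+-commutativeSemigroup using (x∙yz≈y∙xz)
open import Data.Product using (_×_; _,_; ∃; Σ; proj₁; proj₂)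
open import Data.Sum using (_⊎_; inj₁; inj₂)
open import Data.Unit using (tt)
open import Function using (_∘_; _∋_; id)
open import Relation.Binary using (tri<; tri≈; tri>)
open import Relation.Binary.PropositionalEquality
open import Relation.Nullary using (¬_; Dec; yes; no; does)
open import Relation.Nullary.Decidable using (dec-true; dec-false; _×-dec_)
open import Tactic.Cong using (cong!)

-- Evaluation of polynomials and divided differences

Point : Set
Point = ℕ → ℤ

swapCoord : {A : Set} → ℕ → (ℕ → A) → ℕ → A
swapCoord zero    x zero          = x 1
swapCoord zero    x (suc zero)    = x 0
swapCoord zero    x (suc (suc j)) = x (suc (suc j))
swapCoord (suc i) x zero          = x 0
swapCoord (suc i) x (suc j)       = swapCoord i (x ∘ suc) j

swapCoord-at : ∀ i (x : Point) → swapCoord i x i ≡ x (suc i)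
swapCoord-at zero    x = refl
swapCoord-at (suc i) x = swapCoord-at i (x ∘ suc)

swapCoord-at-suc : ∀ i (x : Point) → swapCoord i x (suc i) ≡ x i
swapCoord-at-suc zero    x = refl
swapCoord-at-suc (suc i) x = swapCoord-at-suc i (x ∘ suc)

evalMon : Monomial → Point → ℤ
evalMon []      x = + 1
evalMon (a ∷ e) x = x 0 ^ a * evalMon e (x ∘ suc)

evalPoly : Poly → Point → ℤ
evalPoly []            x = + 0
evalPoly ((c , e) ∷ P) x = c * evalMon e x + evalPoly P x

evalPoly-++ : ∀ P Q x → evalPoly (P ++ Q) x ≡ evalPoly P x + evalPoly Q x
evalPoly-++ []            Q x = sym (ℤₚ.+-identityˡ _)
evalPoly-++ ((c , e) ∷ P) Q x =
  trans (cong (_+_ (c * evalMon e x)) (evalPoly-++ P Q x)) (sym (ℤₚ.+-assoc (c * evalMon e x) _ _))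

cofactor : ℕ → Monomial → Point → ℤ
cofactor i e = evalMon (setE i 0 (setE (suc i) 0 e))

private
  ones : ∀ p q m → p * (q * m) ≡ p * (q * (+ 1 * (+ 1 * m)))
  ones = solve-∀

  pull : ∀ p q r m → r * (p * (q * m)) ≡ p * (q * (r * m))
  pull = solve-∀

evalMon-setE : ∀ i a b e x →
  evalMon (setE i a (setE (suc i) b e)) x ≡ x i ^ a * (x (suc i) ^ b * cofactor i e x)
evalMon-setE zero    a b []          x = refl
evalMon-setE zero    a b (_ ∷ [])    x = refl
evalMon-setE zero    a b (_ ∷ _ ∷ e) x = ones (x 0 ^ a) (x 1 ^ b) _
evalMon-setE (suc i) a b []          x =
  trans (cong (+ 1 *_) (evalMon-setE i a b [] (x ∘ suc))) (pull (x (suc i) ^ a) (x (suc (suc i)) ^ b) (+ 1) _)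
evalMon-setE (suc i) a b (c ∷ e)     x =
  trans (cong (x 0 ^ c *_) (evalMon-setE i a b e (x ∘ suc))) (pull (x (suc i) ^ a) (x (suc (suc i)) ^ b) (x 0 ^ c) _)

evalMon-getE : ∀ i e x →
  evalMon e x ≡ x i ^ getE i e * (x (suc i) ^ getE (suc i) e * cofactor i e x)
evalMon-getE zero    []          x = refl
evalMon-getE zero    (a ∷ [])    x = refl
evalMon-getE zero    (a ∷ b ∷ e) x = ones (x 0 ^ a) (x 1 ^ b) _
evalMon-getE (suc i) []          x =
  trans (cong (+ 1 *_) (evalMon-getE i [] (x ∘ suc))) (pull (+ 1) (+ 1) (+ 1) _)
evalMon-getE (suc i) (c ∷ e)     x =
  trans (cong (x 0 ^ c *_) (evalMon-getE i e (x ∘ suc))) (pull (x (suc i) ^ getE i e) (x (suc (suc i)) ^ getE (suc i) e) (x 0 ^ c) _)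

cofactor-swap : ∀ i e x → cofactor i e (swapCoord i x) ≡ cofactor i e x
cofactor-swap zero    []          x = refl
cofactor-swap zero    (_ ∷ [])    x = refl
cofactor-swap zero    (_ ∷ _ ∷ e) x = refl
cofactor-swap (suc i) []          x = cong (+ 1 *_) (cofactor-swap i [] (x ∘ suc))
cofactor-swap (suc i) (c ∷ e)     x = cong (x 0 ^ c *_) (cofactor-swap i e (x ∘ suc))

private
  distrib-tel : ∀ u t s A B C → u * t ≡ A - B → u * s ≡ B - C → u * (t + s) ≡ A - C
  distrib-tel u t s A B C p q = trans (ℤₚ.*-distribˡ-+ u t s) (trans (cong₂ _+_ p q) (lem A B C))
    where
    lem : ∀ A B C → (A - B) + (B - C) ≡ A - C
    lem = solve-∀

-- Stated for `applyUpTo f d` rather than `upTo d`, because the induction passes from `f` to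
-- `f ∘ suc` and from `T` to `T ∘ suc`.
telescope : ∀ u x (t : ℕ → ℤ × Monomial) (T : ℕ → ℤ) f d →
  (∀ k → k < d → u * (proj₁ (t (f k)) * evalMon (proj₂ (t (f k))) x) ≡ T k - T (suc k)) →
  u * evalPoly (map t (applyUpTo f d)) x ≡ T 0 - T d
telescope u x t T f zero    h = trans (ℤₚ.*-zeroʳ u) (sym (ℤₚ.+-inverseʳ (T 0)))
telescope u x t T f (suc d) h =
  distrib-tel u _ (evalPoly (map t (applyUpTo (f ∘ suc) d)) x) (T 0) (T 1) (T (suc d)) (h 0 (s≤s z≤n))
    (telescope u x t (T ∘ suc) (f ∘ suc) d (λ k k<d → h (suc k) (s≤s k<d)))

private
  pred-∸ : ∀ {a k} → k < a → a ∸ k ≡ suc (a ∸ 1 ∸ k)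
  pred-∸ {suc a} {k} (s≤s k≤a) = ℕₚ.+-∸-assoc 1 k≤a

  ∂-expand : ∀ y z c p q R →
    (y - z) * (c * (p * (q * R))) ≡ c * (y * p * (q * R)) - c * (p * (z * q * R))
  ∂-expand = solve-∀

  ∂-expand-neg : ∀ y z c p q R →
    (y - z) * (- c * (p * (q * R))) ≡ c * (p * (z * q * R)) - c * (y * p * (q * R))
  ∂-expand-neg = solve-∀

  *-swap : ∀ c p q R → c * (p * (q * R)) ≡ c * (q * (p * R))
  *-swap = solve-∀

module _ (i : ℕ) (c : ℤ) (e : Monomial) (x : Point) (a b : ℕ) where
  private
    y z R : ℤ
    y = x i
    z = x (suc i)
    R = cofactor i e x

  -- Times `y - z`, the summand with index `k` is a difference of consecutive terms `T k`, each of
  -- which trades one more factor `y` for a factor `z`. `T 0` is the given term, and `T (a ∸ b)` has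
  -- the two exponents exchanged.
  ∂-eval-> : b < a →
    (y - z) * evalPoly (map (λ k → c , setE i (a ∸ 1 ∸ k) (setE (suc i) (b ℕ.+ k) e)) (upTo (a ∸ b))) x
      ≡ c * (y ^ a * (z ^ b * R)) - c * (z ^ a * (y ^ b * R))
  ∂-eval-> b<a = trans (telescope (y - z) x _ T (λ k → k) (a ∸ b) step) (cong₂ _-_ first last)
    where
    T : ℕ → ℤ
    T k = c * (y ^ (a ∸ k) * (z ^ (b ℕ.+ k) * R))
    first : T 0 ≡ c * (y ^ a * (z ^ b * R))
    first = cong (λ s → c * (y ^ a * (z ^ s * R))) (ℕₚ.+-identityʳ b)
    last : T (a ∸ b) ≡ c * (z ^ a * (y ^ b * R))
    last = trans
      (cong₂ (λ s t → c * (y ^ s * (z ^ t * R)))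
        (ℕₚ.m∸[m∸n]≡n (ℕₚ.<⇒≤ b<a)) (ℕₚ.m+[n∸m]≡n (ℕₚ.<⇒≤ b<a)))
      (*-swap c (y ^ b) (z ^ a) R)
    step : ∀ k → k < a ∸ b →
      (y - z) * (c * evalMon (setE i (a ∸ 1 ∸ k) (setE (suc i) (b ℕ.+ k) e)) x) ≡ T k - T (suc k)
    step k k<d = begin
      (y - z) * (c * evalMon (setE i (a ∸ 1 ∸ k) (setE (suc i) (b ℕ.+ k) e)) x)
        ≡⟨ cong (λ s → (y - z) * (c * s)) (evalMon-setE i _ _ e x) ⟩
      (y - z) * (c * (y ^ (a ∸ 1 ∸ k) * (z ^ (b ℕ.+ k) * R)))
        ≡⟨ ∂-expand y z c (y ^ (a ∸ 1 ∸ k)) (z ^ (b ℕ.+ k)) R ⟩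
      c * (y ^ suc (a ∸ 1 ∸ k) * (z ^ (b ℕ.+ k) * R)) - c * (y ^ (a ∸ 1 ∸ k) * (z ^ suc (b ℕ.+ k) * R))
        ≡⟨ cong₂ _-_
             (cong (λ s → c * (y ^ s * (z ^ (b ℕ.+ k) * R))) (sym (pred-∸ (ℕₚ.<-≤-trans k<d (ℕₚ.m∸n≤m a b)))))
             (cong₂ (λ s t → c * (y ^ s * (z ^ t * R))) (ℕₚ.∸-+-assoc a 1 k) (sym (ℕₚ.+-suc b k))) ⟩
      T k - T (suc k) ∎
      where open ≡-Reasoning

  ∂-eval-< : a < b →
    (y - z) * evalPoly (map (λ k → - c , setE i (a ℕ.+ k) (setE (suc i) (b ∸ 1 ∸ k) e)) (upTo (b ∸ a))) x
      ≡ c * (y ^ a * (z ^ b * R)) - c * (z ^ a * (y ^ b * R))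
  ∂-eval-< a<b = trans (telescope (y - z) x _ T (λ k → k) (b ∸ a) step) (cong₂ _-_ first last)
    where
    T : ℕ → ℤ
    T k = c * (y ^ (a ℕ.+ k) * (z ^ (b ∸ k) * R))
    first : T 0 ≡ c * (y ^ a * (z ^ b * R))
    first = cong (λ s → c * (y ^ s * (z ^ b * R))) (ℕₚ.+-identityʳ a)
    last : T (b ∸ a) ≡ c * (z ^ a * (y ^ b * R))
    last = trans
      (cong₂ (λ s t → c * (y ^ s * (z ^ t * R)))
        (ℕₚ.m+[n∸m]≡n (ℕₚ.<⇒≤ a<b)) (ℕₚ.m∸[m∸n]≡n (ℕₚ.<⇒≤ a<b)))
      (*-swap c (y ^ b) (z ^ a) R)
    step : ∀ k → k < b ∸ a →
      (y - z) * (- c * evalMon (setE i (a ℕ.+ k) (setE (suc i) (b ∸ 1 ∸ k) e)) x) ≡ T k - T (suc k)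
    step k k<d = begin
      (y - z) * (- c * evalMon (setE i (a ℕ.+ k) (setE (suc i) (b ∸ 1 ∸ k) e)) x)
        ≡⟨ cong (λ s → (y - z) * (- c * s)) (evalMon-setE i _ _ e x) ⟩
      (y - z) * (- c * (y ^ (a ℕ.+ k) * (z ^ (b ∸ 1 ∸ k) * R)))
        ≡⟨ ∂-expand-neg y z c (y ^ (a ℕ.+ k)) (z ^ (b ∸ 1 ∸ k)) R ⟩
      c * (y ^ (a ℕ.+ k) * (z ^ suc (b ∸ 1 ∸ k) * R)) - c * (y ^ suc (a ℕ.+ k) * (z ^ (b ∸ 1 ∸ k) * R))
        ≡⟨ cong₂ _-_
             (cong (λ s → c * (y ^ (a ℕ.+ k) * (z ^ s * R))) (sym (pred-∸ (ℕₚ.<-≤-trans k<d (ℕₚ.m∸n≤m b a)))))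
             (cong₂ (λ s t → c * (y ^ s * (z ^ t * R))) (sym (ℕₚ.+-suc a k)) (ℕₚ.∸-+-assoc b 1 k)) ⟩
      T k - T (suc k) ∎
      where open ≡-Reasoning

  ∂-eval-≡ : a ≡ b → (y - z) * + 0 ≡ c * (y ^ a * (z ^ b * R)) - c * (z ^ a * (y ^ b * R))
  ∂-eval-≡ refl = trans (ℤₚ.*-zeroʳ (y - z))
    (sym (trans (cong (λ s → c * (y ^ a * (z ^ b * R)) - s) (*-swap c (z ^ a) (y ^ b) R)) (ℤₚ.+-inverseʳ (c * (y ^ a * (z ^ b * R))))))

∂term-eval : ∀ i c e x →
  (x i - x (suc i)) * evalPoly (∂term i (c , e)) x ≡ c * evalMon e x - c * evalMon e (swapCoord i x)
∂term-eval i c e x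
  -- Once the powers of x_i and x_{i+1} are split off, the swap only exchanges their bases, as the
  -- cofactor is invariant. The two exponents can then be abstracted, so that `∂term` reduces.
  rewrite evalMon-getE i e x | evalMon-getE i e (swapCoord i x)
        | swapCoord-at i x | swapCoord-at-suc i x | cofactor-swap i e x
  with getE i e | getE (suc i) e
... | a | b with b <? a
...   | yes b<a = ∂-eval-> i c e x a b b<a
...   | no b≮a with a <? b
...     | yes a<b = ∂-eval-< i c e x a b a<b
...     | no a≮b  = ∂-eval-≡ i c e x a b (ℕₚ.≤-antisym (ℕₚ.≮⇒≥ b≮a) (ℕₚ.≮⇒≥ a≮b))

∂-eval : ∀ i P x →
  (x i - x (suc i)) * evalPoly (∂ i P) x ≡ evalPoly P x - evalPoly P (swapCoord i x)
∂-eval i []            x = ℤₚ.*-zeroʳ (x i - x (suc i))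
∂-eval i ((c , e) ∷ P) x = begin
  u * evalPoly (∂term i (c , e) ++ ∂ i P) x
    ≡⟨ cong (u *_) (evalPoly-++ (∂term i (c , e)) (∂ i P) x) ⟩
  u * (evalPoly (∂term i (c , e)) x + evalPoly (∂ i P) x)
    ≡⟨ ℤₚ.*-distribˡ-+ u (evalPoly (∂term i (c , e)) x) _ ⟩
  u * evalPoly (∂term i (c , e)) x + u * evalPoly (∂ i P) x
    ≡⟨ cong₂ _+_ (∂term-eval i c e x) (∂-eval i P x) ⟩
  (A - A′) + (B - B′)
    ≡⟨ regroup A A′ B B′ ⟩
  (A + B) - (A′ + B′) ∎
  where
  open ≡-Reasoning
  u A A′ B B′ : ℤ
  u  = x i - x (suc i)
  A  = c * evalMon e x
  A′ = c * evalMon e (swapCoord i x)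
  B  = evalPoly P x
  B′ = evalPoly P (swapCoord i x)
  regroup : ∀ a a′ b b′ → (a - a′) + (b - b′) ≡ (a + b) - (a′ + b′)
  regroup = solve-∀

-- The factors of the columns of the Rothe diagram

-- One position of the word, with `K` the continuation at the new height. At `false` the position
-- lies outside D, and choosing it (weight `y`) raises the height. At `true` it lies in D, and
-- leaving it out lowers the height, which height 0 forbids.
step : Bool → ℕ → ℤ → (ℕ → ℤ) → ℤ
step false h       y K = K h + y * K (suc h)
step true  zero    y K = y * K zero
step true  (suc h) y K = y * K (suc h) + K h

-- For h = 0 this is Σ_{C ≤ D} x^C, where D is the set of positions of the letters > a
-- in the word; along the word, h is the excess of |C| over |D| so far, which has to stay
-- nonnegative and to end at 0.
column : ℕ → ℕ → Word → Point → ℤ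
column zero    a []      x = + 1
column (suc _) a []      x = + 0
column h       a (b ∷ P) x = step (does (a <? b)) h (x 0) (λ k → column k a P (x ∘ suc))

columns : Word → Word → Point → ℤ
columns P []      x = + 1
columns P (a ∷ R) x = column 0 a P x * columns (P ++ a ∷ []) R x

-- The clauses for the empty word split on `h`, so the last clause of `column` does not compute for
-- a variable `h`.
column-∷ : ∀ h a b P x →
  column h a (b ∷ P) x ≡ step (does (a <? b)) h (x 0) (λ k → column k a P (x ∘ suc))
column-∷ zero    a b P x = refl
column-∷ (suc h) a b P x = refl

<?-true : ∀ {a b} → a < b → does (a <? b) ≡ true
<?-true {a} {b} = dec-true (a <? b)

<?-false : ∀ {a b} → ¬ a < b → does (a <? b) ≡ false
<?-false {a} {b} = dec-false (a <? b)

step-cong : ∀ c h y {K L : ℕ → ℤ} → (∀ k → K k ≡ L k) → step c h y K ≡ step c h y L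
step-cong false h       y eq = cong₂ (λ s t → s + y * t) (eq h) (eq (suc h))
step-cong true  zero    y eq = cong (y *_) (eq zero)
step-cong true  (suc h) y eq = cong₂ (λ s t → y * s + t) (eq (suc h)) (eq h)

-- Linearity in `K` carries the identity of `column-divided` past the letters in front of the two
-- exchanged positions.
step-linear : ∀ c h y u v {K L M : ℕ → ℤ} →
  (∀ k → (u - v) * K k ≡ u * L k - v * M k) →
  (u - v) * step c h y K ≡ u * step c h y L - v * step c h y M
step-linear false h y u v {K} {L} {M} eq =
  trans (expand u v y (K h) (K (suc h)))
    (trans (cong₂ (λ s t → s + y * t) (eq h) (eq (suc h)))
      (collect u v y (L h) (L (suc h)) (M h) (M (suc h))))
  where
  expand : ∀ u v y a b → (u - v) * (a + y * b) ≡ (u - v) * a + y * ((u - v) * b)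
  expand = solve-∀
  collect : ∀ u v y a b c d →
    (u * a - v * c) + y * (u * b - v * d) ≡ u * (a + y * b) - v * (c + y * d)
  collect = solve-∀
step-linear true zero y u v {K} {L} {M} eq =
  trans (expand u v y (K 0)) (trans (cong (y *_) (eq 0)) (collect u v y (L 0) (M 0)))
  where
  expand : ∀ u v y a → (u - v) * (y * a) ≡ y * ((u - v) * a)
  expand = solve-∀
  collect : ∀ u v y a b → y * (u * a - v * b) ≡ u * (y * a) - v * (y * b)
  collect = solve-∀
step-linear true (suc h) y u v {K} {L} {M} eq =
  trans (expand u v y (K h) (K (suc h)))
    (trans (cong₂ (λ s t → s + y * t) (eq h) (eq (suc h)))
      (collect u v y (L h) (L (suc h)) (M h) (M (suc h))))
  where
  expand : ∀ u v y a b → (u - v) * (y * b + a) ≡ (u - v) * a + y * ((u - v) * b)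
  expand = solve-∀
  collect : ∀ u v y a b c d →
    (u * a - v * c) + y * (u * b - v * d) ≡ u * (y * b + a) - v * (y * d + c)
  collect = solve-∀

-- For two adjacent positions of the same kind, the final height and its admissibility depend only
-- on how many of the two are chosen. So the coefficients are elementary symmetric polynomials in
-- `y` and `z`.
step²-sym : ∀ c h y z (K : ℕ → ℤ) →
  step c h z (λ k → step c k y K) ≡ step c h y (λ k → step c k z K)
step²-sym false h y z K = lem y z (K h) (K (suc h)) (K (suc (suc h)))
  where
  lem : ∀ y z a b c → (a + y * b) + z * (b + y * c) ≡ (a + z * b) + y * (b + z * c)
  lem = solve-∀
step²-sym true zero y z K = lem y z (K 0)
  where
  lem : ∀ y z a → z * (y * a) ≡ y * (z * a)
  lem = solve-∀
step²-sym true (suc zero) y z K = lem y z (K 0) (K 1)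
  where
  lem : ∀ y z a b → z * (y * b + a) + y * a ≡ y * (z * b + a) + z * a
  lem = solve-∀
step²-sym true (suc (suc h)) y z K = lem y z (K h) (K (suc h)) (K (suc (suc h)))
  where
  lem : ∀ y z a b c → z * (y * c + b) + (y * b + a) ≡ y * (z * c + b) + (z * b + a)
  lem = solve-∀

-- At positive height both orders of the two kinds give the same expression, symmetric in `y` and
-- `z`, and the identity is trivial. At height 0 the operator sends `y * K 0 + y * z * K 1` to
-- `(y + z) * K 0 + y * z * K 1`.
step²-divided : ∀ h y z (K : ℕ → ℤ) →
  (y - z) * step false h y (λ k → step true k z K)
    ≡ y * step true h y (λ k → step false k z K) - z * step true h z (λ k → step false k y K)
step²-divided zero y z K = lem y z (K 0) (K 1)
  where
  lem : ∀ y z a b → (y - z) * (z * a + y * (z * b + a)) ≡ y * (y * (a + z * b)) - z * (z * (a + y * b))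
  lem = solve-∀
step²-divided (suc h) y z K = lem y z (K h) (K (suc h)) (K (suc (suc h)))
  where
  lem : ∀ y z a b c → (y - z) * ((z * b + a) + y * (z * c + b))
    ≡ y * (y * (b + z * c) + (a + z * b)) - z * (z * (b + y * c) + (a + y * b))
  lem = solve-∀

column-swap-short : ∀ i h a P x → length P ℕ.≤ i → column h a P (swapCoord i x) ≡ column h a P x
column-swap-short i       zero    a []      x _         = refl
column-swap-short i       (suc h) a []      x _         = refl
column-swap-short (suc i) h       a (b ∷ P) x (s≤s P≤i)
  rewrite column-∷ h a b P (swapCoord (suc i) x) | column-∷ h a b P x =
  step-cong (does (a <? b)) h (x 0) (λ k → column-swap-short i k a P (x ∘ suc) P≤i)

columns-swap-short : ∀ i P R x → length P ℕ.+ length R ℕ.≤ i →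
  columns P R (swapCoord i x) ≡ columns P R x
columns-swap-short i P []      x _  = refl
columns-swap-short i P (a ∷ R) x le = cong₂ _*_
  (column-swap-short i 0 a P x (ℕₚ.≤-trans (ℕₚ.m≤m+n _ _) le))
  (columns-swap-short i (P ++ a ∷ []) R x (subst (ℕ._≤ i) len le))
  where
  len : length P ℕ.+ suc (length R) ≡ length (P ++ a ∷ []) ℕ.+ length R
  len = trans (sym (ℕₚ.+-assoc (length P) 1 (length R)))
              (cong (ℕ._+ length R) (sym (Listₚ.length-++ P)))

columns-++ : ∀ P R S x → columns P (R ++ S) x ≡ columns P R x * columns (P ++ R) S x
columns-++ P []      S x rewrite Listₚ.++-identityʳ P = sym (ℤₚ.*-identityˡ _)
columns-++ P (a ∷ R) S x
  rewrite columns-++ (P ++ a ∷ []) R S x | Listₚ.++-assoc P (a ∷ []) R =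
  sym (ℤₚ.*-assoc (column 0 a P x) _ _)

-- Every position lies in D, so C = D is forced and the new position contributes its coordinate.
column-above : ∀ {a b} P x → All (a <_) P → a < b →
  column 0 a (P ++ b ∷ []) x ≡ x (length P) * column 0 a P x
column-above []      x []          a<b rewrite <?-true a<b = refl
column-above {a} (c ∷ P) x (a<c ∷ a<P) a<b
  rewrite <?-true a<c | column-above P (x ∘ suc) a<P a<b =
  comm (x 0) (x (suc (length P))) (column 0 a P (x ∘ suc))
  where
  comm : ∀ p q r → p * (q * r) ≡ q * (p * r)
  comm = solve-∀

-- Without letters > `a` the height never falls, so a positive height cannot end at 0.
column-below-suc : ∀ h {a} P x → All (ℕ._≤ a) P → column (suc h) a P x ≡ + 0
column-below-suc h []      x []          = refl
column-below-suc h (b ∷ P) x (b≤a ∷ P≤a)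
  rewrite <?-false (ℕₚ.≤⇒≯ b≤a) | column-below-suc h P (x ∘ suc) P≤a | column-below-suc (suc h) P (x ∘ suc) P≤a =
  trans (ℤₚ.+-identityˡ _) (ℤₚ.*-zeroʳ (x 0))

column-below : ∀ {a} P x → All (ℕ._≤ a) P → column 0 a P x ≡ + 1
column-below []      x []          = refl
column-below (b ∷ P) x (b≤a ∷ P≤a)
  rewrite <?-false (ℕₚ.≤⇒≯ b≤a) | column-below P (x ∘ suc) P≤a | column-below-suc 0 P (x ∘ suc) P≤a =
  cong (_+_ (+ 1)) (ℤₚ.*-zeroʳ (x 0))

-- The letters > `a` come first and must all be chosen, which keeps the height at 0. No later letter
-- could undo a rise, so the position of `b` cannot be chosen.
column-decreasing : ∀ {a b} P x → AllPairs _>_ P → b ℕ.≤ a →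
  column 0 a (P ++ b ∷ []) x ≡ column 0 a P x
column-decreasing {a} {b} []      x []          b≤a = column-below (b ∷ []) x (b≤a ∷ [])
column-decreasing {a} {b} (c ∷ P) x (c>P ∷ P↘) b≤a with a <? c
... | yes a<c rewrite <?-true a<c = cong (x 0 *_) (column-decreasing P (x ∘ suc) P↘ b≤a)
... | no  a≮c rewrite <?-false a≮c = cong₂ (λ s t → s + x 0 * t)
      (trans (column-below (P ++ b ∷ []) _ Pb≤a) (sym (column-below P _ P≤a)))
      (trans (column-below-suc 0 (P ++ b ∷ []) _ Pb≤a) (sym (column-below-suc 0 P _ P≤a)))
  where
  P≤a : All (ℕ._≤ a) P
  P≤a = All.map (λ p<c → ℕₚ.≤-trans (ℕₚ.<⇒≤ p<c) (ℕₚ.≮⇒≥ a≮c)) c>P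
  Pb≤a : All (ℕ._≤ a) (P ++ b ∷ [])
  Pb≤a = Allₚ.++⁺ P≤a (b≤a ∷ [])

-- Position 0 lies in D for every letter of `w`, and at height 0 it has to be chosen.
columns-dominated : ∀ {b} P w x → All (_< b) w →
  columns (b ∷ P) w x ≡ x 0 ^ length w * columns P w (x ∘ suc)
columns-dominated P []      x []          = refl
columns-dominated {b} P (a ∷ w) x (a<b ∷ w<b)
  rewrite <?-true a<b | columns-dominated (P ++ a ∷ []) w x w<b =
  lem (x 0) (column 0 a P (x ∘ suc)) (x 0 ^ length w) (columns (P ++ a ∷ []) w (x ∘ suc))
  where
  lem : ∀ y c p k → y * c * (p * k) ≡ y * p * (c * k)
  lem = solve-∀

columns-decreasing : ∀ w x → AllPairs _>_ w → columns [] w x ≡ evalMon (downFrom (length w)) x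
columns-decreasing []      x []         = refl
columns-decreasing (a ∷ w) x (a>w ∷ w↘) =
  trans (ℤₚ.*-identityˡ _) (trans (columns-dominated [] w x a>w)
    (cong (x 0 ^ length w *_) (columns-decreasing w (x ∘ suc) w↘)))

column-exchange-sym : ∀ {p q a} l s h x → does (a <? p) ≡ does (a <? q) →
  column h a (l ++ q ∷ p ∷ s) x ≡ column h a (l ++ p ∷ q ∷ s) x
column-exchange-sym {p} {q} {a} [] s h x eq
  rewrite column-∷ h a q (p ∷ s) x | column-∷ h a p (q ∷ s) x | eq =
  step-cong (does (a <? q)) h (x 0) λ k →
    trans (column-∷ k a p s _) (trans (cong (λ c → step c k (x 1) (λ j → column j a s (x ∘ suc ∘ suc))) eq) (sym (column-∷ k a q s _)))
column-exchange-sym {p} {q} {a} (c ∷ l) s h x eq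
  rewrite column-∷ h a c (l ++ q ∷ p ∷ s) x | column-∷ h a c (l ++ p ∷ q ∷ s) x =
  step-cong (does (a <? c)) h (x 0) λ k → column-exchange-sym l s k (x ∘ suc) eq

column-swap-sym : ∀ {p q a} l s h x → does (a <? p) ≡ does (a <? q) →
  column h a (l ++ p ∷ q ∷ s) (swapCoord (length l) x) ≡ column h a (l ++ p ∷ q ∷ s) x
column-swap-sym {p} {q} {a} [] s h x eq
  rewrite column-∷ h a p (q ∷ s) x | column-∷ h a p (q ∷ s) (swapCoord 0 x) | eq = begin
  step c h (x 1) (λ k → column k a (q ∷ s) (swapCoord 0 x ∘ suc))
    ≡⟨ step-cong c h (x 1) (λ k → column-∷ k a q s (swapCoord 0 x ∘ suc)) ⟩
  step c h (x 1) (λ k → step c k (x 0) K)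
    ≡⟨ step²-sym c h (x 0) (x 1) K ⟩
  step c h (x 0) (λ k → step c k (x 1) K)
    ≡⟨ step-cong c h (x 0) (λ k → sym (column-∷ k a q s (x ∘ suc))) ⟩
  step c h (x 0) (λ k → column k a (q ∷ s) (x ∘ suc)) ∎
  where
  open ≡-Reasoning
  c : Bool
  c = does (a <? q)
  K : ℕ → ℤ
  K k = column k a s (x ∘ suc ∘ suc)
column-swap-sym {p} {q} {a} (c ∷ l) s h x eq
  rewrite column-∷ h a c (l ++ p ∷ q ∷ s) x
        | column-∷ h a c (l ++ p ∷ q ∷ s) (swapCoord (suc (length l)) x) =
  step-cong (does (a <? c)) h (x 0) λ k → column-swap-sym l s k (x ∘ suc) eq

-- The Demazure operator f ↦ ∂_i (x_i f) applied to a factor.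
column-divided : ∀ {p q a} l s h x → a < p → ¬ a < q → let i = length l in
  (x i - x (suc i)) * column h a (l ++ q ∷ p ∷ s) x
    ≡ x i * column h a (l ++ p ∷ q ∷ s) x - x (suc i) * column h a (l ++ p ∷ q ∷ s) (swapCoord i x)
column-divided {p} {q} {a} [] s h x a<p a≮q
  rewrite column-∷ h a q (p ∷ s) x | column-∷ h a p (q ∷ s) x | column-∷ h a p (q ∷ s) (swapCoord 0 x)
        | <?-true a<p | <?-false a≮q = begin
  (x 0 - x 1) * step false h (x 0) (λ k → column k a (p ∷ s) (x ∘ suc))
    ≡⟨ cong ((x 0 - x 1) *_) (step-cong false h (x 0) (above (x ∘ suc))) ⟩
  (x 0 - x 1) * step false h (x 0) (λ k → step true k (x 1) K)
    ≡⟨ step²-divided h (x 0) (x 1) K ⟩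
  x 0 * step true h (x 0) (λ k → step false k (x 1) K) - x 1 * step true h (x 1) (λ k → step false k (x 0) K)
    ≡⟨ cong₂ (λ s t → x 0 * s - x 1 * t)
         (step-cong true h (x 0) (λ k → sym (below (x ∘ suc) k)))
         (step-cong true h (x 1) (λ k → sym (below (swapCoord 0 x ∘ suc) k))) ⟩
  x 0 * step true h (x 0) (λ k → column k a (q ∷ s) (x ∘ suc))
    - x 1 * step true h (x 1) (λ k → column k a (q ∷ s) (swapCoord 0 x ∘ suc)) ∎
  where
  open ≡-Reasoning
  K : ℕ → ℤ
  K k = column k a s (x ∘ suc ∘ suc)
  above : ∀ y k → column k a (p ∷ s) y ≡ step true k (y 0) (λ k → column k a s (y ∘ suc))
  above y k rewrite column-∷ k a p s y | <?-true a<p = refl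
  below : ∀ y k → column k a (q ∷ s) y ≡ step false k (y 0) (λ k → column k a s (y ∘ suc))
  below y k rewrite column-∷ k a q s y | <?-false a≮q = refl
column-divided {p} {q} {a} (c ∷ l) s h x a<p a≮q
  rewrite column-∷ h a c (l ++ q ∷ p ∷ s) x | column-∷ h a c (l ++ p ∷ q ∷ s) x
        | column-∷ h a c (l ++ p ∷ q ∷ s) (swapCoord (suc (length l)) x) =
  step-linear (does (a <? c)) h (x 0) (x (suc (length l))) (x (suc (suc (length l))))
    {λ k → column k a (l ++ q ∷ p ∷ s) (x ∘ suc)}
    {λ k → column k a (l ++ p ∷ q ∷ s) (x ∘ suc)}
    {λ k → column k a (l ++ p ∷ q ∷ s) (swapCoord (length l) (x ∘ suc))} λ k → column-divided l s k (x ∘ suc) a<p a≮q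

-- The product of the column factors under an exchange of adjacent letters

module _ {p q : ℕ} (q<p : q < p) (l : Word) (x : Point) where
  private
    i : ℕ
    i = length l

    snoc : ∀ p q s a → (l ++ p ∷ q ∷ s) ++ a ∷ [] ≡ l ++ p ∷ q ∷ (s ++ a ∷ [])
    snoc p q s a = Listₚ.++-assoc l (p ∷ q ∷ s) (a ∷ [])

    same : ∀ {a} → ¬ (q ℕ.≤ a × a < p) → does (a <? p) ≡ does (a <? q)
    same {a} outside with a <? q
    ... | yes a<q = trans (<?-true (ℕₚ.<-trans a<q q<p)) (sym (<?-true a<q))
    ... | no  a≮q = trans (<?-false (λ a<p → outside (ℕₚ.≮⇒≥ a≮q , a<p))) (sym (<?-false a≮q))

  columns-exchange-sym : ∀ s r → All (λ a → ¬ (q ℕ.≤ a × a < p)) r →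
    columns (l ++ q ∷ p ∷ s) r x ≡ columns (l ++ p ∷ q ∷ s) r x
  columns-exchange-sym s []      []             = refl
  columns-exchange-sym s (a ∷ r) (out ∷ r-out)
    rewrite snoc p q s a | snoc q p s a =
    cong₂ _*_ (column-exchange-sym {p} {q} {a} l s 0 x (same out)) (columns-exchange-sym (s ++ a ∷ []) r r-out)

  columns-swap-sym : ∀ s r → All (λ a → ¬ (q ℕ.≤ a × a < p)) r →
    columns (l ++ p ∷ q ∷ s) r (swapCoord i x) ≡ columns (l ++ p ∷ q ∷ s) r x
  columns-swap-sym s []      []             = refl
  columns-swap-sym s (a ∷ r) (out ∷ r-out) rewrite snoc p q s a =
    cong₂ _*_ (column-swap-sym {p} {q} {a} l s 0 x (same out)) (columns-swap-sym (s ++ a ∷ []) r r-out)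

  -- A letter outside the interval from `q` to `p` does not distinguish `p` from `q`, so its factor
  -- is symmetric and can be pulled out. At most one letter is left for `column-divided`. The word
  -- `s` collects the letters of the tail already passed.
  columns-divided : ∀ s r → AllPairs (λ a b → ¬ ((q ℕ.≤ a × a < p) × (q ℕ.≤ b × b < p))) r →
    (x i - x (suc i)) * columns (l ++ q ∷ p ∷ s) r x
      ≡ x i * columns (l ++ p ∷ q ∷ s) r x - x (suc i) * columns (l ++ p ∷ q ∷ s) r (swapCoord i x)
  columns-divided s [] [] = lem (x i) (x (suc i))
    where
    lem : ∀ y z → (y - z) * + 1 ≡ y * + 1 - z * + 1
    lem = solve-∀
  columns-divided s (a ∷ r) (a-r ∷ rs) rewrite snoc p q s a | snoc q p s a
    with (q ℕ.≤? a) ×-dec (a <? p)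
  ... | yes inside@(q≤a , a<p)
    rewrite columns-exchange-sym (s ++ a ∷ []) r (All.map (λ ¬both b → ¬both (inside , b)) a-r)
          | columns-swap-sym (s ++ a ∷ []) r (All.map (λ ¬both b → ¬both (inside , b)) a-r) =
    trans (sym (ℤₚ.*-assoc (x i - x (suc i)) (column 0 a (l ++ q ∷ p ∷ s) x) V))
      (trans (cong (_* V) (column-divided l s 0 x a<p (ℕₚ.≤⇒≯ q≤a)))
        (lem (x i) (x (suc i)) (column 0 a (l ++ p ∷ q ∷ s) x) (column 0 a (l ++ p ∷ q ∷ s) (swapCoord i x)) V))
    where
    V : ℤ
    V = columns (l ++ p ∷ q ∷ (s ++ a ∷ [])) r x
    lem : ∀ y z c d V → (y * c - z * d) * V ≡ y * (c * V) - z * (d * V)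
    lem = solve-∀
  ... | no outside
    rewrite column-exchange-sym {p} {q} {a} l s 0 x (same outside) | column-swap-sym {p} {q} {a} l s 0 x (same outside) =
    trans (expand (x i - x (suc i)) c _)
      (trans (cong (c *_) (columns-divided (s ++ a ∷ []) r rs))
        (collect c (x i) (x (suc i)) (columns (l ++ p ∷ q ∷ (s ++ a ∷ [])) r x) _))
    where
    c : ℤ
    c = column 0 a (l ++ p ∷ q ∷ s) x
    expand : ∀ u c U → u * (c * U) ≡ c * (u * U)
    expand = solve-∀
    collect : ∀ c y z V W → c * (y * V - z * W) ≡ y * (c * V) - z * (c * W)
    collect = solve-∀

  -- The factor x_i required by the Demazure operator comes from column `q`: all of `l` and `p` lie
  -- above `q`, so putting `p` before `q` multiplies this column by x_i. Column `p` does not change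
  -- when `q` is put before it, and the columns of `l` do not read the swapped coordinates.
  columns-ascent : ∀ r → All (q <_) l → AllPairs _>_ l →
    AllPairs (λ a b → ¬ ((q ℕ.≤ a × a < p) × (q ℕ.≤ b × b < p))) r →
    (x i - x (suc i)) * columns [] (l ++ q ∷ p ∷ r) x
      ≡ columns [] (l ++ p ∷ q ∷ r) x - columns [] (l ++ p ∷ q ∷ r) (swapCoord i x)
  columns-ascent r q<l l↘ r-pairs
    rewrite columns-++ [] l (q ∷ p ∷ r) x
          | columns-++ [] l (p ∷ q ∷ r) x
          | columns-++ [] l (p ∷ q ∷ r) (swapCoord i x)
          | columns-swap-short i [] l x ℕₚ.≤-refl
          | column-decreasing {p} {q} l x l↘ (ℕₚ.<⇒≤ q<p)
          | column-above l x q<l q<p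
          | column-above l (swapCoord i x) q<l q<p
          | swapCoord-at i x
          | column-swap-short i 0 p l x ℕₚ.≤-refl
          | column-swap-short i 0 q l x ℕₚ.≤-refl
          | Listₚ.++-assoc l (q ∷ []) (p ∷ [])
          | Listₚ.++-assoc l (p ∷ []) (q ∷ []) =
    trans (expand (x i - x (suc i)) L Q P _)
      (trans (cong (L * Q * P *_) (columns-divided [] r r-pairs))
        (collect L Q P (x i) (x (suc i)) (columns (l ++ p ∷ q ∷ []) r x) _))
    where
    L P Q : ℤ
    L = columns [] l x
    P = column 0 p l x
    Q = column 0 q l x
    expand : ∀ u L Q P U → u * (L * (Q * (P * U))) ≡ L * Q * P * (u * U)
    expand = solve-∀
    collect : ∀ L Q P y z V W →
      L * Q * P * (y * V - z * W) ≡ L * (P * (y * Q * V)) - L * (P * (z * Q * W))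
    collect = solve-∀

swapCoord-∘ : ∀ {A B : Set} i (f : A → B) (x : ℕ → A) j → swapCoord i (f ∘ x) j ≡ f (swapCoord i x j)
swapCoord-∘ zero    f x zero          = refl
swapCoord-∘ zero    f x (suc zero)    = refl
swapCoord-∘ zero    f x (suc (suc j)) = refl
swapCoord-∘ (suc i) f x zero          = refl
swapCoord-∘ (suc i) f x (suc j)       = swapCoord-∘ i f (x ∘ suc) j

swapCoord-involutive : ∀ {A : Set} i (x : ℕ → A) j → swapCoord i (swapCoord i x) j ≡ x j
swapCoord-involutive zero    x zero          = refl
swapCoord-involutive zero    x (suc zero)    = refl
swapCoord-involutive zero    x (suc (suc j)) = refl
swapCoord-involutive (suc i) x zero          = refl
swapCoord-involutive (suc i) x (suc j)       = swapCoord-involutive i (x ∘ suc) j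

-- The descent along first ascents

Injective : Point → Set
Injective x = ∀ {i j} → x i ≡ x j → i ≡ j

-- `swapCoord i x` agrees pointwise with `x ∘ τ`, where the transposition `τ` is an involution.
swapCoord-injective : ∀ i {x} → Injective x → Injective (swapCoord i x)
swapCoord-injective i {x} x-inj {j} {k} eq = trans (sym (ττ j)) (trans (cong τ τj≡τk) (ττ k))
  where
  τ : ℕ → ℕ
  τ = swapCoord i id
  ττ : ∀ j → τ (τ j) ≡ j
  ττ j = trans (sym (swapCoord-∘ i τ id j)) (swapCoord-involutive i id j)
  τj≡τk : τ j ≡ τ k
  τj≡τk = x-inj (trans (sym (swapCoord-∘ i x id j)) (trans eq (swapCoord-∘ i x id k)))

-- With distinct letters, avoiding 1432 and 1423 says: after z p with z < p,
-- at most one of the later letters lies between z and p.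
Good : Word → Set
Good w = ∀ {z p a b} → (z ∷ p ∷ a ∷ b ∷ []) ⊆ w → z < a → a < p → z < b → b < p → ⊥

-- The bound keeps `q` out of `s`, so `s` never uses both exchanged positions.
⊆-exchange : ∀ l {p q r s} → All (q <_) s → s ⊆ (l ++ p ∷ q ∷ r) → s ⊆ (l ++ q ∷ p ∷ r)
⊆-exchange []      q<s         (p ∷ʳ (q ∷ʳ s⊆))     = q ∷ʳ p ∷ʳ s⊆
⊆-exchange []      (q<q ∷ _)   (p ∷ʳ (refl ∷ s⊆))   = ⊥-elim (ℕₚ.<-irrefl refl q<q)
⊆-exchange []      q<s         (refl ∷ (q ∷ʳ s⊆))   = q ∷ʳ refl ∷ s⊆
⊆-exchange []      (_ ∷ q<q ∷ _) (refl ∷ refl ∷ s⊆) = ⊥-elim (ℕₚ.<-irrefl refl q<q)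
⊆-exchange (c ∷ l) q<s         (.c ∷ʳ s⊆)           = c ∷ʳ ⊆-exchange l q<s s⊆
⊆-exchange (c ∷ l) (_ ∷ q<s)   (refl ∷ s⊆)          = refl ∷ ⊆-exchange l q<s s⊆

-- An occurrence starting in `l` has all its letters above `q`, so it survives the exchange. One
-- starting later could use both exchanged letters only as its first two, and would then need
-- `p < q`.
Good-exchange : ∀ l {p q r} → q < p → All (q <_) l → Good (l ++ q ∷ p ∷ r) → Good (l ++ p ∷ q ∷ r)
Good-exchange [] q<p _ good (p ∷ʳ (q ∷ʳ s⊆))   = good (q ∷ʳ p ∷ʳ s⊆)
Good-exchange [] q<p _ good (p ∷ʳ (refl ∷ s⊆)) = good (refl ∷ p ∷ʳ s⊆)
Good-exchange [] q<p _ good (refl ∷ (q ∷ʳ s⊆)) = good (q ∷ʳ refl ∷ s⊆)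
Good-exchange [] q<p _ good (refl ∷ refl ∷ s⊆) p<a a<q _ _ = ℕₚ.<-asym q<p (ℕₚ.<-trans p<a a<q)
Good-exchange (c ∷ l) q<p (_ ∷ q<l)   good (.c ∷ʳ s⊆) = Good-exchange l q<p q<l (λ s → good (c ∷ʳ s)) s⊆
Good-exchange (c ∷ l) q<p (q<c ∷ q<l) good (refl ∷ s⊆) c<a a<p c<b b<p =
  good (refl ∷ ⊆-exchange l
    (ℕₚ.<-trans q<c (ℕₚ.<-trans c<a a<p) ∷ ℕₚ.<-trans q<c c<a ∷ ℕₚ.<-trans q<c c<b ∷ []) s⊆) c<a a<p c<b b<p

exchange-↭ : ∀ (l : Word) p q r → (l ++ q ∷ p ∷ r) ↭ (l ++ p ∷ q ∷ r)
exchange-↭ l p q r = Permₚ.++⁺ˡ l (Perm.swap q p Perm.refl)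

Unique-resp-↭ : ∀ {v w : Word} → v ↭ w → Unique v → Unique w
Unique-resp-↭ v↭w = Permₛ.Unique-resp-↭ (setoid ℕ) (Perm.↭⇒↭ₛ v↭w)

nonInv-exchange : ∀ l {p q} r → q < p → nonInv (l ++ q ∷ p ∷ r) ≡ suc (nonInv (l ++ p ∷ q ∷ r))
nonInv-exchange [] {p} {q} r q<p
  rewrite Listₚ.filter-accept (q <?_) {xs = r} q<p
        | Listₚ.filter-reject (p <?_) {xs = r} (ℕₚ.<-asym q<p) =
  cong suc (x∙yz≈y∙xz (length (filter (q <?_) r)) (length (filter (p <?_) r)) (nonInv r))
nonInv-exchange (c ∷ l) {p} {q} r q<p = trans (cong₂ ℕ._+_ same-count (nonInv-exchange l r q<p)) (ℕₚ.+-suc _ _)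
  where
  same-count : length (filter (c <?_) (l ++ q ∷ p ∷ r)) ≡ length (filter (c <?_) (l ++ p ∷ q ∷ r))
  same-count = Permₚ.↭-length (Permₚ.filter-↭ (c <?_) (exchange-↭ l p q r))

swapAt-length : ∀ l q p r → swapAt (length l) (l ++ q ∷ p ∷ r) ≡ l ++ p ∷ q ∷ r
swapAt-length []      q p r = refl
swapAt-length (c ∷ l) q p r = cong (c ∷_) (swapAt-length l q p r)

data FirstAscent : Word → Maybe ℕ → Set where
  none : ∀ {w} → AllPairs _>_ w → FirstAscent w nothing
  at   : ∀ {w} l q p r → w ≡ l ++ q ∷ p ∷ r → q < p → All (q <_) l → AllPairs _>_ l →
         FirstAscent w (just (length l))

FirstAscent-∷ : ∀ {a b w k} → b < a → FirstAscent (b ∷ w) k → FirstAscent (a ∷ b ∷ w) (Maybe.map suc k)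
FirstAscent-∷ b<a (none (b>w ∷ w↘)) =
  none ((b<a ∷ All.map (λ c<b → ℕₚ.<-trans c<b b<a) b>w) ∷ b>w ∷ w↘)
FirstAscent-∷ {a} b<a (at [] q p r refl q<p [] []) = at (a ∷ []) q p r refl q<p (b<a ∷ []) ([] ∷ [])
FirstAscent-∷ {a} b<a (at (b ∷ l) q p r refl q<p (q<b ∷ q<l) (b>l ∷ l↘)) =
  at (a ∷ b ∷ l) q p r refl q<p (ℕₚ.<-trans q<b b<a ∷ q<b ∷ q<l)
    ((b<a ∷ All.map (λ c<b → ℕₚ.<-trans c<b b<a) b>l) ∷ b>l ∷ l↘)

-- The recursive worker of firstAscent is local to its definition, hence it has no name
-- here, and its hidden parameters (the first letter x and the remaining word v of the
-- whole word) obstruct an induction on firstAscent itself.  Below, `ascentStep x v a b d w`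
-- is that worker on a ∷ b ∷ w once it has compared a with b: unification first
-- recovers it underneath a stuck case distinction, and then anti-unification exposes it
-- (on a goal which the match on tt has normalised).
private
  mutual
    wrappedStep : (x : ℕ) → Word → (a : ℕ) → ¬ x < a → Word → (b : ℕ) → Dec (a < b) → Word → Maybe ℕ
    wrappedStep = _

    wrappedStep-def : ∀ x a b w →
      x < a ⊎ Σ (¬ x < a) λ x≮a → firstAscent (x ∷ a ∷ b ∷ w) ≡ wrappedStep x (a ∷ b ∷ w) a x≮a (b ∷ w) b (a <? b) w
    wrappedStep-def x a b w with x <? a
    ... | yes x<a = inj₁ x<a
    ... | no  x≮a with a <? b
    ...   | d with Word ∋ a ∷ b ∷ w
    ...     | v with Word ∋ b ∷ w
    ...       | u = inj₂ (x≮a , refl)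

  mutual
    ascentStep : (x : ℕ) → Word → (a b : ℕ) → Dec (a < b) → Word → Maybe ℕ
    ascentStep = _

    ascentStep-def : ∀ x v a x≮a u b d w c (a≮c : ¬ a < c) w′ →
      ascentStep x v a b d w ≡ ascentStep x v a c (no a≮c) w′ →
      wrappedStep x v a x≮a u b d w ≡ wrappedStep x v a x≮a u c (no a≮c) w′
    ascentStep-def x v a x≮a u b d w c a≮c w′ eq with tt
    ... | tt = cong! eq

-- The hidden parameters `x` and `v` stay fixed while the recursion moves along the word.
-- Distinctness turns a failed comparison into a strict descent.
ascentStep-spec : ∀ x v a b w → Unique (a ∷ b ∷ w) →
  FirstAscent (a ∷ b ∷ w) (ascentStep x v a b (a <? b) w)
ascentStep-spec x v a b w ((a≢b ∷ _) ∷ b∷w!) with a <? b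
... | yes a<b = at [] a b w refl a<b [] []
ascentStep-spec x v a b []      ((a≢b ∷ _) ∷ b∷w!) | no a≮b =
  none ((ℕₚ.≤∧≢⇒< (ℕₚ.≮⇒≥ a≮b) (a≢b ∘ sym) ∷ []) ∷ [] ∷ [])
ascentStep-spec x v a b (c ∷ w) ((a≢b ∷ _) ∷ b∷w!) | no a≮b
  with ascentStep x v b c (b <? c) w | ascentStep-spec x v b c w b∷w!
... | nothing | fa = FirstAscent-∷ (ℕₚ.≤∧≢⇒< (ℕₚ.≮⇒≥ a≮b) (a≢b ∘ sym)) fa
... | just _  | fa = FirstAscent-∷ (ℕₚ.≤∧≢⇒< (ℕₚ.≮⇒≥ a≮b) (a≢b ∘ sym)) fa

firstAscent-spec : ∀ w → Unique w → FirstAscent w (firstAscent w)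
firstAscent-spec []          _  = none []
firstAscent-spec (a ∷ [])    _  = none ([] ∷ [])
firstAscent-spec (a ∷ b ∷ w) w! = ascentStep-spec a (b ∷ w) a b w w!

AllPairs-⊆ : ∀ {R : ℕ → ℕ → Set} w → (∀ {a b} → (a ∷ b ∷ []) ⊆ w → R a b) → AllPairs R w
AllPairs-⊆ []      f = []
AllPairs-⊆ (a ∷ w) f = All.tabulate (λ b∈w → f (refl ∷ from∈ b∈w)) ∷ AllPairs-⊆ w (λ ab⊆w → f (a ∷ʳ ab⊆w))

Unique-++⁻ʳ : ∀ l {w : Word} → Unique (l ++ w) → Unique w
Unique-++⁻ʳ []      w!       = w!
Unique-++⁻ʳ (_ ∷ l) (_ ∷ w!) = Unique-++⁻ʳ l w!

-- The letters `q` and `p` themselves serve as the first two letters of the forbidden configuration.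
Good-between : ∀ l {p q} r → Unique (l ++ q ∷ p ∷ r) → Good (l ++ q ∷ p ∷ r) →
  AllPairs (λ a b → ¬ ((q ℕ.≤ a × a < p) × (q ℕ.≤ b × b < p))) r
Good-between l {p} {q} r w! good with Unique-++⁻ʳ l w!
... | (_ ∷ q∉r) ∷ _ = AllPairs-⊆ r λ ab⊆r ((q≤a , a<p) , (q≤b , b<p)) →
  good (++⁺ˡ l (refl ∷ refl ∷ ab⊆r)) (ℕₚ.≤∧≢⇒< q≤a (All.lookup q∉r (to∈ ab⊆r))) a<p
    (ℕₚ.≤∧≢⇒< q≤b (All.lookup q∉r (to∈ (∷ˡ⁻ ab⊆r)))) b<p

private
  dominant : ∀ w x → AllPairs _>_ w → + 1 * evalMon (downFrom (length w)) x + + 0 ≡ columns [] w x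
  dominant w x w↘ = trans (simp (evalMon (downFrom (length w)) x)) (sym (columns-decreasing w x w↘))
    where
    simp : ∀ m → + 1 * m + + 0 ≡ m
    simp = solve-∀

-- Induction on the fuel, which each exchange at the first ascent lowers together with `nonInv` by
-- exactly one; with no fuel left there is no ascent. The point varies because the divided
-- difference needs the induction hypothesis at `x` and at its swap.
schubGo-eval : ∀ m f w x → m ≡ length w → Injective x → Unique w → Good w → nonInv w ≡ f →
  evalPoly (schubGo m f w) x ≡ columns [] w x
schubGo-eval m zero w x refl x-inj w! good f-eq with firstAscent w | firstAscent-spec w w!
... | _ | none w↘ = dominant w x w↘
... | _ | at l q p r refl q<p _ _ with trans (sym f-eq) (nonInv-exchange l r q<p)
... | ()
schubGo-eval m (suc f) w x m-eq x-inj w! good f-eq with firstAscent w | firstAscent-spec w w!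
... | _ | none w↘ rewrite m-eq = dominant w x w↘
... | _ | at l q p r refl q<p q<l l↘ rewrite swapAt-length l q p r =
  ℤₚ.*-cancelˡ-≡ (x i - x (suc i)) _ _ {{ℤ.≢-nonZero xi≢}} (begin
    (x i - x (suc i)) * evalPoly (∂ i S) x
      ≡⟨ ∂-eval i S x ⟩
    evalPoly S x - evalPoly S (swapCoord i x)
      ≡⟨ cong₂ _-_ (ih x x-inj) (ih (swapCoord i x) (swapCoord-injective i x-inj)) ⟩
    columns [] w′ x - columns [] w′ (swapCoord i x)
      ≡⟨ columns-ascent q<p l x r q<l l↘ (Good-between l r w! good) ⟨
    (x i - x (suc i)) * columns [] (l ++ q ∷ p ∷ r) x ∎)
  where
  open ≡-Reasoning
  i : ℕ
  i = length l
  w′ : Word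
  w′ = l ++ p ∷ q ∷ r
  S : Poly
  S = schubGo m f w′
  xi≢ : x i - x (suc i) ≢ + 0
  xi≢ eq = ℕₚ.1+n≢n (sym (x-inj (ℤₚ.i-j≡0⇒i≡j (x i) (x (suc i)) eq)))
  ih : ∀ y → Injective y → evalPoly S y ≡ columns [] w′ y
  ih y y-inj = schubGo-eval m f w′ y (trans m-eq (Permₚ.↭-length (exchange-↭ l p q r))) y-inj
    (Unique-resp-↭ (exchange-↭ l p q r) w!) (Good-exchange l q<p q<l good)
    (ℕₚ.suc-injective (trans (sym (nonInv-exchange l r q<p)) f-eq))

-- Congruences and the passage to the point `𝟙`

module _ (N : ℕ) where
  infix 4 _≈_
  -- Congruence modulo `N`, oriented so that matching on `refl` eliminates the left-hand side.
  record _≈_ (a b : ℤ) : Set where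
    constructor _,_
    field
      quotient : ℤ
      equality : a ≡ b + + N * quotient

  ≈-refl : ∀ {a} → a ≈ a
  ≈-refl {a} = + 0 , sym (trans (cong (_+_ a) (ℤₚ.*-zeroʳ (+ N))) (ℤₚ.+-identityʳ a))

  ≈-trans : ∀ {a b c} → a ≈ b → b ≈ c → a ≈ c
  ≈-trans {c = c} (k , refl) (j , refl) = j + k , lem c (+ N) k j
    where
    lem : ∀ c n k j → c + n * j + n * k ≡ c + n * (j + k)
    lem = solve-∀

  +-≈ : ∀ {a b c d} → a ≈ b → c ≈ d → a + c ≈ b + d
  +-≈ {b = b} {d = d} (k , refl) (j , refl) = k + j , lem b d (+ N) k j
    where
    lem : ∀ b d n k j → (b + n * k) + (d + n * j) ≡ (b + d) + n * (k + j)
    lem = solve-∀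

  *-≈ : ∀ {a b c d} → a ≈ b → c ≈ d → a * c ≈ b * d
  *-≈ {b = b} {d = d} (k , refl) (j , refl) = b * j + k * d + + N * k * j , lem b d (+ N) k j
    where
    lem : ∀ b d n k j → (b + n * k) * (d + n * j) ≡ b * d + n * (b * j + k * d + n * k * j)
    lem = solve-∀

  ^-≈ : ∀ {a b} e → a ≈ b → a ^ e ≈ b ^ e
  ^-≈ zero    p = ≈-refl
  ^-≈ (suc e) p = *-≈ p (^-≈ e p)

  evalMon-≈ : ∀ e {x y} → (∀ j → x j ≈ y j) → evalMon e x ≈ evalMon e y
  evalMon-≈ []      p = ≈-refl
  evalMon-≈ (a ∷ e) p = *-≈ (^-≈ a (p 0)) (evalMon-≈ e (p ∘ suc))

  evalPoly-≈ : ∀ P {x y} → (∀ j → x j ≈ y j) → evalPoly P x ≈ evalPoly P y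
  evalPoly-≈ []            p = ≈-refl
  evalPoly-≈ ((c , e) ∷ P) p = +-≈ (*-≈ (≈-refl {c}) (evalMon-≈ e p)) (evalPoly-≈ P p)

  step-≈ : ∀ c h {y z} {K L : ℕ → ℤ} → y ≈ z → (∀ k → K k ≈ L k) → step c h y K ≈ step c h z L
  step-≈ false h       p q = +-≈ (q h) (*-≈ p (q (suc h)))
  step-≈ true  zero    p q = *-≈ p (q 0)
  step-≈ true  (suc h) p q = +-≈ (*-≈ p (q (suc h))) (q h)

  column-≈ : ∀ h a P {x y} → (∀ j → x j ≈ y j) → column h a P x ≈ column h a P y
  column-≈ zero    a []      p = ≈-refl
  column-≈ (suc h) a []      p = ≈-refl
  column-≈ h       a (b ∷ P) {x} {y} p rewrite column-∷ h a b P x | column-∷ h a b P y =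
    step-≈ (does (a <? b)) h (p 0) (λ k → column-≈ k a P (p ∘ suc))

  columns-≈ : ∀ P R {x y} → (∀ j → x j ≈ y j) → columns P R x ≈ columns P R y
  columns-≈ P []      p = ≈-refl
  columns-≈ P (a ∷ R) p = *-≈ (column-≈ 0 a P p) (columns-≈ (P ++ a ∷ []) R p)

𝟙 : Point
𝟙 _ = + 1

evalPoly-𝟙 : ∀ P → evalPoly P 𝟙 ≡ eval1 P
evalPoly-𝟙 []            = refl
evalPoly-𝟙 ((c , e) ∷ P) = cong₂ _+_ (trans (cong (c *_) (evalMon-𝟙 e)) (ℤₚ.*-identityʳ c)) (evalPoly-𝟙 P)
  where
  evalMon-𝟙 : ∀ e → evalMon e 𝟙 ≡ + 1
  evalMon-𝟙 []      = refl
  evalMon-𝟙 (a ∷ e) = cong₂ _*_ (ℤₚ.^-zeroˡ a) (evalMon-𝟙 e)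

-- The modulus 1 + |a - b| exceeds the difference in absolute value, so it divides it only if the
-- difference is 0.
≈-every⇒≡ : ∀ a b → (∀ n → _≈_ (suc n) a b) → a ≡ b
≈-every⇒≡ a b a≈b with a≈b ∣ a - b ∣
... | k , eq = ℤₚ.i-j≡0⇒i≡j a b (trans a-b≡ (trans (cong (+ N *_) (k≡0 k ∣k∣≡)) (ℤₚ.*-zeroʳ (+ N))))
  where
  N : ℕ
  N = suc ∣ a - b ∣
  a-b≡ : a - b ≡ + N * k
  a-b≡ = trans (cong (_- b) eq) (lem b (+ N * k))
    where
    lem : ∀ b c → b + c - b ≡ c
    lem = solve-∀
  ∣k∣≡ : ∣ a - b ∣ ≡ N ℕ.* ∣ k ∣
  ∣k∣≡ = trans (cong ∣_∣ a-b≡) (ℤₚ.abs-* (+ N) k)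
  k≡0 : ∀ k → ∣ a - b ∣ ≡ N ℕ.* ∣ k ∣ → k ≡ + 0
  k≡0 k eq with ∣ k ∣ in ∣k∣
  ... | zero  = ℤₚ.∣i∣≡0⇒i≡0 ∣k∣
  ... | suc j = ⊥-elim (ℕₚ.<⇒≢ (ℕₚ.m≤m*n N (suc j)) eq)

-- The evaluation at 𝟙 is not covered by schubGo-eval, whose points have distinct
-- coordinates, but it is congruent modulo every N to the one at the points 1 + N j.
schubert1-columns : ∀ w → Unique w → Good w → schubert1 w ≡ columns [] w 𝟙
schubert1-columns w w! good = trans (sym (evalPoly-𝟙 (schubert w))) (≈-every⇒≡ _ _ congruent)
  where
  congruent : ∀ n → _≈_ (suc n) (evalPoly (schubert w) 𝟙) (columns [] w 𝟙)
  congruent n = ≈-trans (suc n)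
    (evalPoly-≈ (suc n) (schubert w) 𝟙≈x)
    (subst (λ c → _≈_ (suc n) c (columns [] w 𝟙))
      (sym (schubGo-eval (length w) (nonInv w) w x refl x-inj w! good refl))
      (columns-≈ (suc n) [] w (λ j → + j , refl)))
    where
    x : Point
    x j = + 1 + + suc n * + j
    𝟙≈x : ∀ j → _≈_ (suc n) (𝟙 j) (x j)
    𝟙≈x j = - (+ j) , lem (+ suc n) (+ j)
      where
      lem : ∀ n j → + 1 ≡ + 1 + n * j + n * - j
      lem = solve-∀
    x-inj : Injective x
    x-inj {i} {j} eq =
      ℤₚ.+-injective (ℤₚ.*-cancelˡ-≡ (+ suc n) (+ i) (+ j) (∙-cancelˡ (+ 1) _ _ eq))

-- Inclusion–exclusion over the subwords of a word

-- Says that f v = Σ_{s ⊆ v} g s for all v ⊆ w, with every g s ≥ 0.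
Möbius≥0 : Word → (Word → ℤ) → Set
Möbius≥0 []      f = + 0 ≤ f []
Möbius≥0 (a ∷ w) f = Möbius≥0 w f × Möbius≥0 w (λ v → f (a ∷ v) - f v)

Möbius≥0-cong : ∀ w {f g} → (∀ v → v ⊆ w → f v ≡ g v) → Möbius≥0 w f → Möbius≥0 w g
Möbius≥0-cong []      eq m = subst (+ 0 ≤_) (eq [] []) m
Möbius≥0-cong (a ∷ w) eq (m , m′) =
  Möbius≥0-cong w (λ v v⊆w → eq v (a ∷ʳ v⊆w)) m ,
  Möbius≥0-cong w (λ v v⊆w → cong₂ _-_ (eq (a ∷ v) (refl ∷ v⊆w)) (eq v (a ∷ʳ v⊆w))) m′

Möbius≥0-const : ∀ w {c} → + 0 ≤ c → Möbius≥0 w (λ _ → c)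
Möbius≥0-const []      0≤c = 0≤c
Möbius≥0-const (a ∷ w) {c} 0≤c = Möbius≥0-const w 0≤c , Möbius≥0-const w (ℤₚ.≤-reflexive (sym (ℤₚ.+-inverseʳ c)))

Möbius≥0-+ : ∀ w {f g} → Möbius≥0 w f → Möbius≥0 w g → Möbius≥0 w (λ v → f v + g v)
Möbius≥0-+ []      m n = ℤₚ.+-mono-≤ m n
Möbius≥0-+ (a ∷ w) {f} {g} (m , m′) (n , n′) =
  Möbius≥0-+ w m n ,
  Möbius≥0-cong w (λ v _ → regroup (f (a ∷ v)) (f v) (g (a ∷ v)) (g v)) (Möbius≥0-+ w m′ n′)
  where
  regroup : ∀ p q r s → (p - q) + (r - s) ≡ (p + r) - (q + s)
  regroup = solve-∀

-- The coefficient of the product at s is the sum of the products of coefficients over all pairs of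
-- subwords with union s. The induction uses the discrete Leibniz rule Δ(fg) = f Δg + Δf g + Δf Δg.
Möbius≥0-* : ∀ w {f g} → Möbius≥0 w f → Möbius≥0 w g → Möbius≥0 w (λ v → f v * g v)
Möbius≥0-* []      {f} m n = 0≤* m n
  where
  0≤* : ∀ {i j} → + 0 ≤ i → + 0 ≤ j → + 0 ≤ i * j
  0≤* {+ i} {+ j} _ _ = subst (+ 0 ≤_) (ℤₚ.pos-* i j) (+≤+ z≤n)
Möbius≥0-* (a ∷ w) {f} {g} (m , m′) (n , n′) =
  Möbius≥0-* w m n ,
  Möbius≥0-cong w (λ v _ → expand (f (a ∷ v)) (f v) (g (a ∷ v)) (g v))
    (Möbius≥0-+ w (Möbius≥0-+ w (Möbius≥0-* w m n′) (Möbius≥0-* w m′ n)) (Möbius≥0-* w m′ n′))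
  where
  expand : ∀ p q r s → q * (r - s) + (p - q) * s + (p - q) * (r - s) ≡ p * r - q * s
  expand = solve-∀

-- The interval sum as an iterated difference: letters of `w` skipped by the embedding are kept with
-- sign + or deleted with sign -, and letters of `u` are always kept.
alternating : ∀ {u w} → u ⊆ w → (Word → ℤ) → ℤ
alternating []               f = f []
alternating (a ∷ʳ τ)         f = alternating τ (λ v → f (a ∷ v)) - alternating τ f
alternating (_∷_ {x = a} _ τ) f = alternating τ (λ v → f (a ∷ v))

alternating-sub : ∀ {u w} (τ : u ⊆ w) f g →
  alternating τ (λ v → f v - g v) ≡ alternating τ f - alternating τ g
alternating-sub []       f g = refl
alternating-sub (a ∷ʳ τ) f g = trans
  (cong₂ _-_ (alternating-sub τ (λ v → f (a ∷ v)) (λ v → g (a ∷ v))) (alternating-sub τ f g))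
  (regroup (alternating τ (λ v → f (a ∷ v))) _ (alternating τ f) _)
  where
  regroup : ∀ p q r s → (p - q) - (r - s) ≡ (p - r) - (q - s)
  regroup = solve-∀
alternating-sub (_∷_ {x = a} _ τ) f g = alternating-sub τ (λ v → f (a ∷ v)) (λ v → g (a ∷ v))

-- In terms of the coefficients g, cancellation leaves the sum of g s over those s which contain
-- every letter of `w` skipped by the embedding.
alternating-nonneg : ∀ {u w} (τ : u ⊆ w) f → Möbius≥0 w f → + 0 ≤ alternating τ f
alternating-nonneg []       f m        = m
alternating-nonneg (a ∷ʳ τ) f (_ , m′) =
  subst (+ 0 ≤_) (alternating-sub τ (λ v → f (a ∷ v)) f) (alternating-nonneg τ _ m′)
alternating-nonneg {w = _ ∷ w} (_∷_ {x = a} refl τ) f (m , m′) =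
  alternating-nonneg τ (λ v → f (a ∷ v))
    (Möbius≥0-cong w (λ v _ → cancel (f v) (f (a ∷ v))) (Möbius≥0-+ w m m′))
  where
  cancel : ∀ p q → p + (q - p) ≡ q
  cancel = solve-∀

-- The signed sum over an interval as an iterated difference

sumOver : (Word → ℤ) → List Word → ℤ
sumOver f L = sumℤ (map f L)

sumOver-++ : ∀ f L M → sumOver f (L ++ M) ≡ sumOver f L + sumOver f M
sumOver-++ f []      M = sym (ℤₚ.+-identityˡ _)
sumOver-++ f (v ∷ L) M = trans (cong (_+_ (f v)) (sumOver-++ f L M)) (sym (ℤₚ.+-assoc (f v) _ _))

sumOver-neg : ∀ f g L → All (λ v → f v ≡ - g v) L → sumOver f L ≡ - sumOver g L
sumOver-neg f g []      []         = refl
sumOver-neg f g (v ∷ L) (eq ∷ eqs) =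
  trans (cong₂ _+_ eq (sumOver-neg f g L eqs)) (sym (ℤₚ.neg-distrib-+ (g v) (sumOver g L)))

subwords-⊆ : ∀ w → All (_⊆ w) (subwords w)
subwords-⊆ []      = [] ∷ []
subwords-⊆ (a ∷ w) = Allₚ.++⁺ (Allₚ.map⁺ (All.map (refl ∷_) (subwords-⊆ w))) (All.map (a ∷ʳ_) (subwords-⊆ w))

⊆-∷⁻ : ∀ {u v : Word} {a} → a ∉ u → u ⊆ (a ∷ v) → u ⊆ v
⊆-∷⁻ a∉u (_ ∷ʳ u⊆v)  = u⊆v
⊆-∷⁻ a∉u (refl ∷ _) = ⊥-elim (a∉u (here refl))

-- Used with `u′` equal to `u` if `a` does not occur in `u`, and with `u′` the tail of `u` if `u`
-- begins with `a`.
filter-map-∷ : ∀ (u u′ : Word) a → (∀ v → u ⊆ (a ∷ v) → u′ ⊆ v) → (∀ v → u′ ⊆ v → u ⊆ (a ∷ v)) → ∀ L →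
  filter (u ⊆?_) (map (a ∷_) L) ≡ map (a ∷_) (filter (u′ ⊆?_) L)
filter-map-∷ u u′ a to from []      = refl
filter-map-∷ u u′ a to from (v ∷ L) with u′ ⊆? v
... | yes p = trans (Listₚ.filter-accept (u ⊆?_) (from v p)) (cong ((a ∷ v) ∷_) (filter-map-∷ u u′ a to from L))
... | no ¬p = trans (Listₚ.filter-reject (u ⊆?_) (¬p ∘ to v)) (filter-map-∷ u u′ a to from L)

signed : ℕ → (Word → ℤ) → Word → ℤ
signed n f v = sgn (n ∸ length v) * f v

sumOver-signed-∷ : ∀ n a f L →
  sumOver (signed (suc n) f) (map (a ∷_) L) ≡ sumOver (signed n (λ v → f (a ∷ v))) L
sumOver-signed-∷ n a f []      = refl
sumOver-signed-∷ n a f (v ∷ L) = cong (_+_ (signed n (λ v → f (a ∷ v)) v)) (sumOver-signed-∷ n a f L)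

∈-irrefl : ∀ {a} {w : Word} → All (a ≢_) w → a ∉ w
∈-irrefl a≢w a∈w = All.lookup a≢w a∈w refl

-- The subwords split into those with and those without the first letter `a`. If `a` is skipped,
-- both halves run over the same filtered list with opposite signs. If `u` begins with `a`,
-- distinctness rules out the second half.
intervalSum-alternating : ∀ {u w} (τ : u ⊆ w) → Unique w → ∀ f →
  sumOver (signed (length w) f) (filter (u ⊆?_) (subwords w)) ≡ alternating τ f
intervalSum-alternating [] _ f = simp (f [])
  where
  simp : ∀ c → + 1 * c + + 0 ≡ c
  simp = solve-∀
intervalSum-alternating {u} {a ∷ w} (.a ∷ʳ τ) (a≢w ∷ w!) f = begin
  sumOver (signed (suc (length w)) f) (filter (u ⊆?_) (map (a ∷_) (subwords w) ++ subwords w))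
    ≡⟨ cong (sumOver _) (Listₚ.filter-++ (u ⊆?_) (map (a ∷_) (subwords w)) _) ⟩
  sumOver (signed (suc (length w)) f) (filter (u ⊆?_) (map (a ∷_) (subwords w)) ++ M)
    ≡⟨ sumOver-++ (signed (suc (length w)) f) (filter (u ⊆?_) (map (a ∷_) (subwords w))) M ⟩
  sumOver (signed (suc (length w)) f) (filter (u ⊆?_) (map (a ∷_) (subwords w)))
    + sumOver (signed (suc (length w)) f) M
    ≡⟨ cong₂ _+_
         (trans (cong (sumOver (signed (suc (length w)) f))
                  (filter-map-∷ u u a (λ _ → ⊆-∷⁻ a∉u) (λ _ → a ∷ʳ_) (subwords w)))
                (sumOver-signed-∷ (length w) a f M))
         (sumOver-neg (signed (suc (length w)) f) (signed (length w) f) M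
           (Allₚ.filter⁺ (u ⊆?_) (All.map flip-sign (subwords-⊆ w)))) ⟩
  sumOver (signed (length w) (λ v → f (a ∷ v))) M - sumOver (signed (length w) f) M
    ≡⟨ cong₂ _-_ (intervalSum-alternating τ w! (λ v → f (a ∷ v))) (intervalSum-alternating τ w! f) ⟩
  alternating τ (λ v → f (a ∷ v)) - alternating τ f ∎
  where
  open ≡-Reasoning
  M : List Word
  M = filter (u ⊆?_) (subwords w)
  a∉u : a ∉ u
  a∉u a∈u = ∈-irrefl a≢w (lookup τ a∈u)
  flip-sign : ∀ {v} → v ⊆ w → signed (suc (length w)) f v ≡ - signed (length w) f v
  -- The bound |v| ≤ |w| ensures that the truncated subtraction really grows by one.
  flip-sign {v} v⊆w rewrite ℕₚ.+-∸-assoc 1 (length-mono-≤ v⊆w) =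
    sym (ℤₚ.neg-distribˡ-* (sgn (length w ∸ length v)) (f v))
intervalSum-alternating {a ∷ u} {.a ∷ w} (refl ∷ τ) (a≢w ∷ w!) f = begin
  sumOver (signed (suc (length w)) f) (filter ((a ∷ u) ⊆?_) (map (a ∷_) (subwords w) ++ subwords w))
    ≡⟨ cong (sumOver _) (Listₚ.filter-++ ((a ∷ u) ⊆?_) (map (a ∷_) (subwords w)) _) ⟩
  sumOver (signed (suc (length w)) f)
    (filter ((a ∷ u) ⊆?_) (map (a ∷_) (subwords w)) ++ filter ((a ∷ u) ⊆?_) (subwords w))
    ≡⟨ cong (sumOver _) (trans
         (cong₂ _++_
           (filter-map-∷ (a ∷ u) u a (λ _ → ∷⁻) (λ _ → refl ∷_) (subwords w))
           (Listₚ.filter-none ((a ∷ u) ⊆?_)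
             (All.map (λ v⊆w a∷u⊆v → ∈-irrefl a≢w (to∈ (⊆-trans a∷u⊆v v⊆w))) (subwords-⊆ w))))
         (Listₚ.++-identityʳ _)) ⟩
  sumOver (signed (suc (length w)) f) (map (a ∷_) (filter (u ⊆?_) (subwords w)))
    ≡⟨ sumOver-signed-∷ (length w) a f (filter (u ⊆?_) (subwords w)) ⟩
  sumOver (signed (length w) (λ v → f (a ∷ v))) (filter (u ⊆?_) (subwords w))
    ≡⟨ intervalSum-alternating τ w! (λ v → f (a ∷ v)) ⟩
  alternating τ (λ v → f (a ∷ v)) ∎
  where open ≡-Reasoning

-- Column factors at `𝟙` as functions of the subword

-- `idle a v` is the factor of a at x = 1 if a occurs in v, and 1 otherwise.  It counts Dyck
-- subwords before a; `run a h` takes over from height h once the first letter is chosen.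
run : ℕ → ℕ → Word → ℤ
run a h []      = + 0
run a h (b ∷ v) with b ℕ.≟ a
-- The end condition: 1 at height 0, and 0 at positive height.
... | yes _ = column h a [] 𝟙
... | no  _ = step (does (a <? b)) h (+ 1) (λ k → run a k v)

idle : ℕ → Word → ℤ
idle a []      = + 1
idle a (b ∷ v) with b ℕ.≟ a
... | yes _ = + 1
... | no  _ with a <? b
...   | yes _ = idle a v
...   | no  _ = idle a v + run a 1 v

run-∉ : ∀ a h v → a ∉ v → run a h v ≡ + 0
run-∉ a h []      _   = refl
run-∉ a h (b ∷ v) a∉ with b ℕ.≟ a
... | yes refl = ⊥-elim (a∉ (here refl))
... | no  _    = trans (step-cong (does (a <? b)) h (+ 1) (λ k → run-∉ a k v (a∉ ∘ there))) (step-0 (does (a <? b)) h)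
  where
  step-0 : ∀ c h → step c h (+ 1) (λ _ → + 0) ≡ + 0
  step-0 false h       = refl
  step-0 true  zero    = refl
  step-0 true  (suc h) = refl

idle-∉ : ∀ a v → a ∉ v → idle a v ≡ + 1
idle-∉ a []      _  = refl
idle-∉ a (b ∷ v) a∉ with b ℕ.≟ a
... | yes _ = refl
... | no  _ with a <? b
...   | yes _ = idle-∉ a v (a∉ ∘ there)
...   | no  _ = cong₂ _+_ (idle-∉ a v (a∉ ∘ there)) (run-∉ a 1 v (a∉ ∘ there))

run-column : ∀ a h P R → All (a ≢_) P → run a h (P ++ a ∷ R) ≡ column h a P 𝟙
run-column a h []      R _ with a ℕ.≟ a
... | yes _   = refl
... | no  a≢a = ⊥-elim (a≢a refl)
run-column a h (b ∷ P) R (a≢b ∷ a≢P) with b ℕ.≟ a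
... | yes b≡a = ⊥-elim (a≢b (sym b≡a))
... | no  _   = trans (step-cong (does (a <? b)) h (+ 1) (λ k → run-column a k P R a≢P)) (sym (column-∷ h a b P 𝟙))

idle-column : ∀ a P R → All (a ≢_) P → idle a (P ++ a ∷ R) ≡ column 0 a P 𝟙
idle-column a []      R _ with a ℕ.≟ a
... | yes _   = refl
... | no  a≢a = ⊥-elim (a≢a refl)
idle-column a (b ∷ P) R (a≢b ∷ a≢P) with b ℕ.≟ a
... | yes b≡a = ⊥-elim (a≢b (sym b≡a))
... | no  _ with a <? b
...   | yes a<b rewrite <?-true a<b = trans (idle-column a P R a≢P) (sym (ℤₚ.*-identityˡ _))
...   | no  a≮b rewrite <?-false a≮b =
  cong₂ _+_ (idle-column a P R a≢P) (trans (run-column a 1 P R a≢P) (sym (ℤₚ.*-identityˡ _)))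

-- The coefficient at s is 1 if s is a path from height `h` to 0 followed by `a`, and 0 otherwise.
-- Hence a new first letter changes `run` by its value after an up or down step.
Möbius≥0-run : ∀ a h w → Unique w → Möbius≥0 w (run a h)
Möbius≥0-run a h []      _          = +≤+ z≤n
Möbius≥0-run a h (b ∷ w) (b≢w ∷ w!) = Möbius≥0-run a h w w! , difference
  where
  column-[]-nonneg : ∀ h → + 0 ≤ column h a [] 𝟙
  column-[]-nonneg zero    = +≤+ z≤n
  column-[]-nonneg (suc _) = +≤+ z≤n
  step-difference : ∀ c h → Möbius≥0 w (λ v → step c h (+ 1) (λ k → run a k v) - run a h v)
  step-difference false h = Möbius≥0-cong w (λ v _ → lem (run a h v) (run a (suc h) v)) (Möbius≥0-run a (suc h) w w!)
    where
    lem : ∀ p q → q ≡ p + + 1 * q - p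
    lem = solve-∀
  step-difference true zero = Möbius≥0-cong w (λ v _ → lem (run a 0 v)) (Möbius≥0-const w (+≤+ z≤n))
    where
    lem : ∀ p → + 0 ≡ + 1 * p - p
    lem = solve-∀
  step-difference true (suc h) = Möbius≥0-cong w (λ v _ → lem (run a (suc h) v) (run a h v)) (Möbius≥0-run a h w w!)
    where
    lem : ∀ p q → q ≡ + 1 * p + q - p
    lem = solve-∀
  difference : Möbius≥0 w (λ v → run a h (b ∷ v) - run a h v)
  difference with b ℕ.≟ a
  ... | yes refl = Möbius≥0-cong w
    (λ v v⊆w → sym (trans (cong (λ r → column h a [] 𝟙 - r) (run-∉ a h v (∈-irrefl (All-resp-⊆ v⊆w b≢w)))) (ℤₚ.+-identityʳ _)))
    (Möbius≥0-const w (column-[]-nonneg h))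
  ... | no _ = step-difference (does (a <? b)) h

-- The coefficient is 1 at the empty word and at each nonempty Dyck word followed by `a`, and 0
-- elsewhere.
Möbius≥0-idle : ∀ a w → Unique w → Möbius≥0 w (idle a)
Möbius≥0-idle a []      _          = +≤+ z≤n
Möbius≥0-idle a (b ∷ w) (b≢w ∷ w!) = Möbius≥0-idle a w w! , difference
  where
  difference : Möbius≥0 w (λ v → idle a (b ∷ v) - idle a v)
  difference with b ℕ.≟ a
  ... | yes refl = Möbius≥0-cong w
    (λ v v⊆w → sym (cong (λ r → + 1 - r) (idle-∉ a v (∈-irrefl (All-resp-⊆ v⊆w b≢w)))))
    (Möbius≥0-const w (+≤+ z≤n))
  ... | no _ with a <? b
  ...   | yes _ = Möbius≥0-cong w (λ v _ → sym (ℤₚ.+-inverseʳ (idle a v))) (Möbius≥0-const w (+≤+ z≤n))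
  ...   | no  _ = Möbius≥0-cong w (λ v _ → lem (idle a v) (run a 1 v)) (Möbius≥0-run a 1 w w!)
    where
    lem : ∀ p q → q ≡ p + q - p
    lem = solve-∀

productOver : (ℕ → ℤ) → Word → ℤ
productOver f []      = + 1
productOver f (a ∷ w) = f a * productOver f w

Möbius≥0-productOver : ∀ w (f : ℕ → Word → ℤ) R → (∀ a → Möbius≥0 w (f a)) → Möbius≥0 w (λ v → productOver (λ a → f a v) R)
Möbius≥0-productOver w f []      m = Möbius≥0-const w (+≤+ z≤n)
Möbius≥0-productOver w f (a ∷ R) m = Möbius≥0-* w (m a) (Möbius≥0-productOver w f R m)

productOver-⊆ : ∀ f {v w} → v ⊆ w → Unique w → (∀ {a} → a ∈ w → a ∉ v → f a ≡ + 1) →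
  productOver f w ≡ productOver f v
productOver-⊆ f []         _          _  = refl
productOver-⊆ f (a ∷ʳ v⊆w) (a≢w ∷ w!) f≡1 = trans
  (cong₂ _*_ (f≡1 (here refl) (λ a∈v → ∈-irrefl a≢w (lookup v⊆w a∈v)))
             (productOver-⊆ f v⊆w w! (λ b∈w → f≡1 (there b∈w))))
  (ℤₚ.*-identityˡ _)
productOver-⊆ f (_∷_ {x = a} refl v⊆w) (a≢w ∷ w!) f≡1 =
  cong (f a *_) (productOver-⊆ f v⊆w w! λ b∈w b∉v → f≡1 (there b∈w) λ where
    (here b≡a)  → All.lookup a≢w b∈w (sym b≡a)
    (there b∈v) → b∉v b∈v)

columns-idle : ∀ P R → Unique (P ++ R) → columns P R 𝟙 ≡ productOver (λ a → idle a (P ++ R)) R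
columns-idle P []      _  = refl
columns-idle P (a ∷ R) u! = cong₂ _*_
  (sym (idle-column a P R (first-occurrence P u!)))
  (trans (columns-idle (P ++ a ∷ []) R (subst Unique (sym assoc) u!))
         (cong (λ v → productOver (λ b → idle b v) R) assoc))
  where
  assoc : (P ++ a ∷ []) ++ R ≡ P ++ a ∷ R
  assoc = Listₚ.++-assoc P (a ∷ []) R
  first-occurrence : ∀ P → Unique (P ++ a ∷ R) → All (a ≢_) P
  first-occurrence []      _         = []
  first-occurrence (b ∷ P) (b≢ ∷ u!) = (λ a≡b → All.lookup b≢ (Anyₚ.++⁺ʳ P (here refl)) (sym a≡b)) ∷ first-occurrence P u!

Unique-resp-⊆ : ∀ {v w : Word} → v ⊆ w → Unique w → Unique v
Unique-resp-⊆ []           _          = []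
Unique-resp-⊆ (_ ∷ʳ v⊆w)   (_ ∷ w!)   = Unique-resp-⊆ v⊆w w!
Unique-resp-⊆ (refl ∷ v⊆w) (a≢w ∷ w!) = All-resp-⊆ v⊆w a≢w ∷ Unique-resp-⊆ v⊆w w!

-- Since `idle` is 1 for a missing letter, the product may range over all letters of `w` whatever
-- `v` is, and closure under products applies.
Möbius≥0-columns : ∀ w → Unique w → Möbius≥0 w (λ v → columns [] v 𝟙)
Möbius≥0-columns w w! = Möbius≥0-cong w
  (λ v v⊆w → trans (productOver-⊆ (λ a → idle a v) v⊆w w! (λ {a} _ → idle-∉ a v))
                   (sym (columns-idle [] v (Unique-resp-⊆ v⊆w w!))))
  (Möbius≥0-productOver w idle w (λ a → Möbius≥0-idle a w w!))

-- Standardization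

rank : Word → ℕ → ℕ
rank v a = length (filter (_<? a) v)

rank-accept : ∀ {v a b k} → b < a → rank v a ≡ k → rank (b ∷ v) a ≡ suc k
rank-accept {v} {a} b<a eq = trans (cong length (Listₚ.filter-accept (_<? a) {xs = v} b<a)) (cong suc eq)

rank-reject : ∀ {v a b k} → ¬ b < a → rank v a ≡ k → rank (b ∷ v) a ≡ k
rank-reject {v} {a} b≮a eq = trans (cong length (Listₚ.filter-reject (_<? a) {xs = v} b≮a)) eq

rank-mono-≤ : ∀ v {a b} → a ℕ.≤ b → rank v a ℕ.≤ rank v b
rank-mono-≤ []      a≤b = z≤n
rank-mono-≤ (c ∷ v) {a} {b} a≤b with c <? a | c <? b
... | yes c<a | yes c<b rewrite rank-accept {v} c<a refl | rank-accept {v} c<b refl = s≤s (rank-mono-≤ v a≤b)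
... | yes c<a | no  c≮b = ⊥-elim (c≮b (ℕₚ.<-≤-trans c<a a≤b))
... | no  c≮a | yes c<b rewrite rank-reject {v} c≮a refl | rank-accept {v} c<b refl = ℕₚ.m≤n⇒m≤1+n (rank-mono-≤ v a≤b)
... | no  c≮a | no  c≮b rewrite rank-reject {v} c≮a refl | rank-reject {v} c≮b refl = rank-mono-≤ v a≤b

-- The letter `a` is itself counted in the rank of `b`, but not in its own.
rank-mono-< : ∀ {v a b} → a ∈ v → a < b → rank v a < rank v b
rank-mono-< {a ∷ v} {b = b} (here refl) a<b
  rewrite rank-reject {v} (ℕₚ.<-irrefl (refl {x = a})) refl | rank-accept {v} a<b refl =
  s≤s (rank-mono-≤ v (ℕₚ.<⇒≤ a<b))
rank-mono-< {c ∷ v} {a} {b} (there a∈v) a<b with c <? a | c <? b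
... | yes c<a | yes c<b rewrite rank-accept {v} c<a refl | rank-accept {v} c<b refl = s≤s (rank-mono-< a∈v a<b)
... | yes c<a | no  c≮b = ⊥-elim (c≮b (ℕₚ.<-trans c<a a<b))
... | no  c≮a | yes c<b rewrite rank-reject {v} c≮a refl | rank-accept {v} c<b refl = ℕₚ.m≤n⇒m≤1+n (rank-mono-< a∈v a<b)
... | no  c≮a | no  c≮b rewrite rank-reject {v} c≮a refl | rank-reject {v} c≮b refl = rank-mono-< a∈v a<b

column-map : ∀ (r : ℕ → ℕ) h a P x → (∀ {b} → b ∈ P → does (r a <? r b) ≡ does (a <? b)) →
  column h (r a) (map r P) x ≡ column h a P x
column-map r zero    a []      x _  = refl
column-map r (suc h) a []      x _  = refl
column-map r h       a (b ∷ P) x eq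
  rewrite column-∷ h (r a) (r b) (map r P) x | column-∷ h a b P x | eq (here refl) =
  step-cong (does (a <? b)) h (x 0) (λ k → column-map r k a P (x ∘ suc) (eq ∘ there))

columns-map : ∀ (r : ℕ → ℕ) P R x → (∀ {a b} → a ∈ R → b ∈ P ++ R → does (r a <? r b) ≡ does (a <? b)) →
  columns (map r P) (map r R) x ≡ columns P R x
columns-map r P []      x _  = refl
columns-map r P (a ∷ R) x eq = cong₂ _*_
  (column-map r 0 a P x (λ b∈P → eq (here refl) (Anyₚ.++⁺ˡ b∈P)))
  (trans (cong (λ Q → columns Q (map r R) x) (sym (Listₚ.map-++ r P (a ∷ []))))
    (columns-map r (P ++ a ∷ []) R x λ c∈R b∈ → eq (there c∈R) (subst (_ ∈_) (Listₚ.++-assoc P (a ∷ []) R) b∈)))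

⊆-map⁻ : ∀ (r : ℕ → ℕ) {s} w → s ⊆ map r w → ∃ λ t → t ⊆ w × s ≡ map r t
⊆-map⁻ r []      []           = [] , [] , refl
⊆-map⁻ r (a ∷ w) (_ ∷ʳ s⊆)    with ⊆-map⁻ r w s⊆
... | t , t⊆w , eq = t , a ∷ʳ t⊆w , eq
⊆-map⁻ r (a ∷ w) (refl ∷ s⊆) with ⊆-map⁻ r w s⊆
... | t , t⊆w , refl = a ∷ t , refl ∷ t⊆w , refl

Good-map : ∀ (r : ℕ → ℕ) w → (∀ {a b} → r a < r b → a < b) → Good w → Good (map r w)
Good-map r w reflects good s⊆ z<a a<p z<b b<p with ⊆-map⁻ r w s⊆
... | _ ∷ _ ∷ _ ∷ _ ∷ [] , t⊆ , refl = good t⊆ (reflects z<a) (reflects a<p) (reflects z<b) (reflects b<p)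

Unique-map : ∀ (r : ℕ → ℕ) w → (∀ {a b} → a ∈ w → b ∈ w → r a ≡ r b → a ≡ b) → Unique w → Unique (map r w)
Unique-map r []      inj _          = []
Unique-map r (a ∷ w) inj (a≢w ∷ w!) =
  Allₚ.map⁺ (All.tabulate (λ b∈w ra≡rb → All.lookup a≢w b∈w (inj (here refl) (there b∈w) ra≡rb)))
  ∷ Unique-map r w (λ a∈w b∈w → inj (there a∈w) (there b∈w)) w!

-- Column factors depend only on comparisons of letters, and these are preserved by ranks within
-- `v`.
schubert1-perm : ∀ v → Unique v → Good v → schubert1 (perm v) ≡ columns [] v 𝟙
schubert1-perm v v! good = trans
  (schubert1-columns (perm v) (Unique-map r v injective v!) (Good-map r v reflects good))
  (columns-map r [] v 𝟙 same)
  where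
  r : ℕ → ℕ
  r a = suc (rank v a)
  reflects : ∀ {a b} → r a < r b → a < b
  reflects ra<rb = ℕₚ.≰⇒> (λ b≤a → ℕₚ.<⇒≱ ra<rb (s≤s (rank-mono-≤ v b≤a)))
  injective : ∀ {a b} → a ∈ v → b ∈ v → r a ≡ r b → a ≡ b
  injective {a} {b} a∈v b∈v ra≡rb with ℕₚ.<-cmp a b
  ... | tri< a<b _ _ = ⊥-elim (ℕₚ.<⇒≢ (s≤s (rank-mono-< a∈v a<b)) ra≡rb)
  ... | tri≈ _ a≡b _ = a≡b
  ... | tri> _ _ b<a = ⊥-elim (ℕₚ.<⇒≢ (s≤s (rank-mono-< b∈v b<a)) (sym ra≡rb))
  same : ∀ {a b} → a ∈ v → b ∈ v → does (r a <? r b) ≡ does (a <? b)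
  same {a} {b} a∈v _ with a <? b
  ... | yes a<b = trans (<?-true (s≤s (rank-mono-< a∈v a<b))) (sym (<?-true a<b))
  ... | no  a≮b = trans (<?-false (a≮b ∘ reflects)) (sym (<?-false a≮b))

-- The two patterns as inequalities between letters

data Rank (a : ℕ) : Word → ℕ → Set where
  []     : Rank a [] 0
  accept : ∀ {b v k} → b < a → Rank a v k → Rank a (b ∷ v) (suc k)
  reject : ∀ {b v k} → ¬ b < a → Rank a v k → Rank a (b ∷ v) k

Rank⇒≡ : ∀ {a v k} → Rank a v k → rank v a ≡ k
Rank⇒≡ []                     = refl
Rank⇒≡ (accept {v = v} b<a R) = rank-accept {v} b<a (Rank⇒≡ R)
Rank⇒≡ (reject {v = v} b≮a R) = rank-reject {v} b≮a (Rank⇒≡ R)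

-- The derivations record the sixteen comparisons in `perm s`, in place of a case distinction on
-- each `_<?_`.
Ranks⇒perm : ∀ {z p a b i j k l} → let s = z ∷ p ∷ a ∷ b ∷ [] in
  Rank z s i → Rank p s j → Rank a s k → Rank b s l → perm s ≡ suc i ∷ suc j ∷ suc k ∷ suc l ∷ []
Ranks⇒perm Z P A B =
  letter Z (letter P (letter A (letter B refl)))
  where
  letter : ∀ {c v k} {s t : Word} → Rank c v k → s ≡ t → _≡_ {A = Word} (suc (rank v c) ∷ s) (suc k ∷ t)
  letter R = cong₂ _∷_ (cong suc (Rank⇒≡ R))

perm-1423 : ∀ {z p a b} → z < a → a < b → b < p → perm (z ∷ p ∷ a ∷ b ∷ []) ≡ 1 ∷ 4 ∷ 2 ∷ 3 ∷ []
perm-1423 {z} {p} {a} {b} z<a a<b b<p = Ranks⇒perm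
  -- The rows give the ranks of `z`, `p`, `a`, `b`; the columns compare with these letters in the
  -- same order.
  (reject ≮     (reject (≯ z<p) (reject (≯ z<a) (reject (≯ z<b) []))))
  (accept z<p   (reject ≮       (accept a<p     (accept b<p     []))))
  (accept z<a   (reject (≯ a<p) (reject ≮       (reject (≯ a<b) []))))
  (accept z<b   (reject (≯ b<p) (accept a<b     (reject ≮       []))))
  where
  open ℕₚ using (<-trans) renaming (<⇒≯ to ≯)
  ≮ : ∀ {c} → ¬ c < c
  ≮ = ℕₚ.<-irrefl refl
  z<b : z < b
  z<b = <-trans z<a a<b
  a<p : a < p
  a<p = <-trans a<b b<p
  z<p : z < p
  z<p = <-trans z<a a<p

perm-1432 : ∀ {z p a b} → z < b → b < a → a < p → perm (z ∷ p ∷ a ∷ b ∷ []) ≡ 1 ∷ 4 ∷ 3 ∷ 2 ∷ []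
perm-1432 {z} {p} {a} {b} z<b b<a a<p = Ranks⇒perm
  (reject ≮     (reject (≯ z<p) (reject (≯ z<a) (reject (≯ z<b) []))))
  (accept z<p   (reject ≮       (accept a<p     (accept b<p     []))))
  (accept z<a   (reject (≯ a<p) (reject ≮       (accept b<a     []))))
  (accept z<b   (reject (≯ b<p) (reject (≯ b<a) (reject ≮       []))))
  where
  open ℕₚ using (<-trans) renaming (<⇒≯ to ≯)
  ≮ : ∀ {c} → ¬ c < c
  ≮ = ℕₚ.<-irrefl refl
  z<a : z < a
  z<a = <-trans z<b b<a
  b<p : b < p
  b<p = <-trans b<a a<p
  z<p : z < p
  z<p = <-trans z<a a<p

Avoids⇒Good : ∀ {w} → Unique w →
  Avoids w (1 ∷ 4 ∷ 3 ∷ 2 ∷ []) → Avoids w (1 ∷ 4 ∷ 2 ∷ 3 ∷ []) → Good w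
Avoids⇒Good w! avoids-1432 avoids-1423 {z} {p} {a} {b} s⊆w z<a a<p z<b b<p with ℕₚ.<-cmp a b
... | tri< a<b _ _ = avoids-1423 (_ , s⊆w , refl , perm-1423 z<a a<b b<p)
... | tri> _ _ b<a = avoids-1432 (_ , s⊆w , refl , perm-1432 z<b b<a a<p)
... | tri≈ _ a≡b _ with Unique-resp-⊆ s⊆w w!
...   | _ ∷ _ ∷ (a≢b ∷ []) ∷ _ = a≢b a≡b

theorem1p3 : (n : ℕ) (w u : Word) → IsPerm n w →
    Avoids w (1 ∷ 4 ∷ 3 ∷ 2 ∷ []) → Avoids w (1 ∷ 4 ∷ 2 ∷ 3 ∷ []) →
    u ⊆ w → + 0 ≤ intervalSum u w
theorem1p3 n w u w↭ avoids-1432 avoids-1423 u⊆w =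
  subst (+ 0 ≤_) (sym intervalSum≡)
    (alternating-nonneg u⊆w (λ v → columns [] v 𝟙) (Möbius≥0-columns w w!))
  where
  w! : Unique w
  w! = Unique-resp-↭ (Perm.↭-sym w↭) (Uniqueₚ.map⁺ ℕₚ.suc-injective (Uniqueₚ.upTo⁺ n))
  good : Good w
  good = Avoids⇒Good w! avoids-1432 avoids-1423
  column-product : ∀ {v} → v ⊆ w → schubert1 (perm v) ≡ columns [] v 𝟙
  column-product {v} v⊆w =
    schubert1-perm v (Unique-resp-⊆ v⊆w w!) (λ s⊆v → good (⊆-trans s⊆v v⊆w))
  intervalSum≡ : intervalSum u w ≡ alternating u⊆w (λ v → columns [] v 𝟙)
  intervalSum≡ = trans
    (cong sumℤ (Listₚ.map-cong-local (Allₚ.filter⁺ (u ⊆?_)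
      (All.map (λ {v} v⊆w → cong (sgn (length w ∸ length v) *_) (column-product v⊆w)) (subwords-⊆ w)))))
    (intervalSum-alternating u⊆w w! (λ v → columns [] v 𝟙))
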